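{- Let $m \geq 3$ and $r \geq 1$ be integers. If $m$ is odd and $r=1$, then the propagation time of the generalized gear graph is $\mathrm{pt}\big(Gr(m,r)\big) = m-1$. Otherwise, $\mathrm{pt}\big(Gr(m,r)\big) = \left\lceil \frac{m(r+1)}{2} \right\rceil - 2$.
   Context: The generalized gear graph $Gr(m,r)$ is the (simple, undirected) graph with vertex set $\{v_i\}_{i=0}^{m(r+1)}$ such that distinct vertices $v_i, v_j$ are adjacent if and only if (for some ordering of the two indices) one of the following holds: (1) $i=0$ and $(r+1) \mid j$; (2) $i,j \neq 0$ and $|i-j|=1$; (3) $\{i,j\} = \{1, m(r+1)\}$. Thus $v_1,\dots,v_{m(r+1)}$ form a cycle and the center $v_0$ is adjacent to the $m$ vertices $v_{(r+1)k}$, $1\le k\le m$. Zero forcing: each vertex of a graph $G$ is initially colored blue or white. Color change rule: if $u$ is blue and $v$ is the only white neighbor of $u$, then $u$ can force $v$ to become blue; blue vertices stay blue. A set $B \subseteq V(G)$ is a zero forcing set of $G$ if, starting with exactly the vertices of $B$ blue, repeated application of the rule eventually makes every vertex blue. The zero forcing number $\mathrm{Z}(G)$ is the minimum cardinality of a zero forcing set of $G$. Propagation time: for a zero forcing set $B$ let $B^{[0]} = B$ and, for $k \geq 1$, let $B^{[k]} = B^{[k-1]} \cup B^{(k)}$, where $B^{(k)}$ is the set of all white vertices that can be forced by the color change rule when $B^{[k-1]}$ is exactly the set of blue vertices (all possible forces are performed simultaneously in each time-step). Then $\mathrm{pt}(G,B)$ is the least $k$ with $B^{[k]} = V(G)$,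 and $\mathrm{pt}(G) = \min\{\mathrm{pt}(G,B) : B \text{ is a zero forcing set of } G \text{ with } |B| = \mathrm{Z}(G)\}$. -}

module Defs where

open import Data.Fin.Base using (Fin; toℕ)
open import Data.Fin.Properties using (all?; any?) renaming (_≟_ to _≟ᶠ_)
open import Data.Fin.Subset using (Subset; ⊤; _∈_; _∉_; _∪_; ⁅_⁆; ∣_∣)
open import Data.Fin.Subset.Properties using (_∈?_)
open import Data.Nat.Base using (ℕ; zero; suc; _+_; _*_; _≤_; ∣_-_∣)
open import Data.Nat.Divisibility using (_∣_; _∣?_)
open import Data.Nat.Properties using (_≟_)
open import Data.Product.Base using (∃-syntax; _×_; _,_)
open import Data.Sum.Base using (_⊎_; swap)
open import Data.Vec.Base using (tabulate)
open import Function.Base using (_∘_)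
open import Level using (0ℓ)
open import Relation.Binary.Core using (Rel)
open import Relation.Binary.Definitions using (Symmetric; Irreflexive)
  renaming (Decidable to Decidable₂)
open import Relation.Binary.PropositionalEquality.Core using (_≡_; _≢_; sym)
open import Relation.Nullary.Decidable.Core
  using (Dec; does; ¬?; _×-dec_; _⊎-dec_; _→-dec_)
open import Relation.Unary using (Pred)

IsLeast : Pred ℕ 0ℓ → Pred ℕ 0ℓ
IsLeast P k = P k × (∀ j → P j → k ≤ j)

record Graph (n : ℕ) : Set₁ where
  field
    Adj    : Rel (Fin n) 0ℓ
    symm   : Symmetric Adj
    irrefl : Irreflexive _≡_ Adj
    adj?   : Decidable₂ Adj

module _ {n : ℕ} (G : Graph n) where
  open Graph G

  CanForce : Subset n → Fin n → Fin n → Set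
  CanForce S u v = u ∈ S × v ∉ S × Adj u v × (∀ w → Adj u w → w ∉ S → w ≡ v)

  canForce? : ∀ S u v → Dec (CanForce S u v)
  canForce? S u v =
    u ∈? S ×-dec ¬? (v ∈? S) ×-dec adj? u v ×-dec
    all? (λ w → adj? u w →-dec (¬? (w ∈? S) →-dec w ≟ᶠ v))

  -- S ⟶* T: T is obtained from S by forces performed one at a time.
  data _⟶*_ : Subset n → Subset n → Set where
    done  : ∀ {S} → S ⟶* S
    force : ∀ {S T} u v → CanForce S u v → (S ∪ ⁅ v ⁆) ⟶* T → S ⟶* T

  ZeroForcing : Subset n → Set
  ZeroForcing B = B ⟶* ⊤

  -- Z(G) ≡ z
  IsZeroForcingNumber : ℕ → Set
  IsZeroForcingNumber = IsLeast (λ z → ∃[ B ] ZeroForcing B × ∣ B ∣ ≡ z)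

  forceable : Subset n → Subset n
  forceable S = tabulate (λ v → does (any? (λ u → canForce? S u v)))

  -- blueAfter B k is B^[k], and forceable (blueAfter B k) is B^(k+1).
  blueAfter : Subset n → ℕ → Subset n
  blueAfter B zero    = B
  blueAfter B (suc k) = blueAfter B k ∪ forceable (blueAfter B k)

  -- pt(G,B) ≡ k
  IsPropagationTimeOf : Subset n → ℕ → Set
  IsPropagationTimeOf B = IsLeast (λ k → blueAfter B k ≡ ⊤)

  -- pt(G) ≡ k
  IsPropagationTime : ℕ → Set
  IsPropagationTime = IsLeast λ k →
    ∃[ B ] ZeroForcing B × IsZeroForcingNumber ∣ B ∣ × IsPropagationTimeOf B k

module _ (m r : ℕ) where

  -- The adjacency conditions for one ordering of the two indices.
  GearEdge : Rel ℕ 0ℓ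
  GearEdge i j =
      (i ≡ 0 × (r + 1) ∣ j)
    ⊎ (i ≢ 0 × j ≢ 0 × ∣ i - j ∣ ≡ 1)
    ⊎ (i ≡ 1 × j ≡ m * (r + 1))

  gearEdge? : Decidable₂ GearEdge
  gearEdge? i j =
          (i ≟ 0 ×-dec (r + 1) ∣? j)
    ⊎-dec (¬? (i ≟ 0) ×-dec ¬? (j ≟ 0) ×-dec ∣ i - j ∣ ≟ 1)
    ⊎-dec (i ≟ 1 ×-dec j ≟ m * (r + 1))

  GearAdj : Rel (Fin (suc (m * (r + 1)))) 0ℓ
  GearAdj u v = u ≢ v × (GearEdge (toℕ u) (toℕ v) ⊎ GearEdge (toℕ v) (toℕ u))

  Gr : Graph (suc (m * (r + 1)))
  Gr = record
    { Adj    = GearAdj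
    ; symm   = λ (u≢v , e) → u≢v ∘ sym , swap e
    ; irrefl = λ u≡v (u≢v , _) → u≢v u≡v
    ; adj?   = λ u v → ¬? (u ≟ᶠ v) ×-dec
        (gearEdge? (toℕ u) (toℕ v) ⊎-dec gearEdge? (toℕ v) (toℕ u))
    }

{-# OPTIONS --safe #-}
module Submission where

-- The rim is treated as p : ℕ → vertices with period n = m(r + 1).  Forcing is
-- monotone, so the blue set may be replaced by a superset that is easy to
-- describe: once the hub is blue, the blue part of the rim is an arc that gains at
-- most one vertex at each end per step, plus at most one spoke vertex forced by
-- the hub when it is the last white one; before that, nothing passes a spoke
-- vertex unless three consecutive rim vertices are blue.  A set of three vertices
-- therefore needs n ≤ 2k + 4 to turn everything blue in k steps.  If r = 1 and m
-- is odd, only arcs symmetric about a spoke vertex could attain this, and their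
-- symmetry stops the hub from ever having a single white neighbour, whence n ≤ 2k
-- + 3.  Up to parity of n, both bounds are attained by three blue vertices that
-- force the hub from a rim vertex between them and later let it force one spoke
-- vertex (or by the hub and two adjacent rim vertices in the exceptional case).

open import Defs
open import Data.Bool.Base using (true; false)
open import Data.Fin.Base using (Fin; zero; suc; toℕ; fromℕ<)
open import Data.Fin.Properties
  using (any?; toℕ-fromℕ<; toℕ-injective; toℕ<n) renaming (_≟_ to _≟ᶠ_)
open import Data.Fin.Subset using (Subset; ⊤; _∈_; _∉_; _⊆_; _∪_; ⁅_⁆; ∣_∣)
open import Data.Fin.Subset.Properties
  using (_∈?_; x∈p∪q⁻; x∈p∪q⁺; p⊆p∪q; x∈⁅x⁆; x∈⁅y⁆⇒x≡y; ∣⁅x⁆∣≡1; ∈⊤; ⊆⊤; ⊆-antisym)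
open import Data.List.Base using (List; []; _∷_; allFin)
open import Data.List.Membership.Propositional using () renaming (_∈_ to _∈ˡ_)
open import Data.List.Membership.Propositional.Properties using (∈-allFin)
open import Data.List.Relation.Unary.Any using (here; there)
open import Data.Nat.Base
open import Data.Nat.Divisibility
open import Data.Nat.DivMod using
  ( m≡m%n+[m/n]*n; m%n<n; m%n%n≡m%n; n%n≡0; m<n⇒m%n≡m; %-distribˡ-+
  ; [m+n]%n≡m%n; [m+kn]%n≡m%n; m*n%n≡0 )
open import Data.Nat.Properties
open import Data.Nat.Tactic.RingSolver using (solve; solve-∀)
open import Data.Product.Base using (Σ-syntax; ∃; ∃-syntax; ∃₂; _×_; _,_; proj₁; proj₂)
open import Data.Sum.Base as Sum using (_⊎_; inj₁; inj₂)
open import Data.Vec.Base as Vec using (Vec; here; there; replicate)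
open import Data.Vec.Membership.Propositional using () renaming (_∈_ to _∈ᵛ_)
open import Data.Vec.Properties using (lookup∘tabulate; []=⇒lookup; lookup⇒[]=)
open import Data.Vec.Relation.Unary.Any using (here; there)
open import Function.Base using (_∘_; case_of_; id)
open import Relation.Binary.Definitions using (tri<; tri≈; tri>)
open import Relation.Binary.PropositionalEquality
open import Relation.Nullary using (¬_; Dec; yes; no; does; contradiction)
open import Relation.Nullary.Decidable using (dec-true; _×-dec_; _⊎-dec_; decidable-stable)

-- The `4` in `n ≤ 4 + k * 2` counts rim vertices: three at the start and one for the hub, on top of
-- two per step. The hub adds only one because it forces when a single neighbour is white, and
-- afterwards every spoke vertex is blue. The obstacle is a blue vertex away from the arc: the third
-- initial vertex, or the one forced by the hub. It is carried along as `d` until the arc meets it,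
-- and the bounds reserve a place for it. The closed sets that dispose of bad starts also show that
-- two vertices never suffice, so the zero forcing number is 3. Indices in ℕ make arcs into
-- intervals, at the price of shifting by full turns whenever room is needed below. For odd `n` the
-- bound leaves one vertex of slack, so the hub's force can be spared. For even `n` outside the
-- exceptional case it is used: opposite the start if `m` is even, and otherwise after an asymmetric
-- start, which takes three consecutive rim vertices without a spoke, hence `4 ≤ s`.

-- Linear arithmetic by certificate: c ≤ d is a sum of hypotheses and k the slack.
lin : ∀ {a b c d} k → c ≤ d → a + d + k ≡ b + c → a ≤ b
lin {a} {b} {c} {d} k c≤d eq = +-cancelʳ-≤ d a b (begin
  a + d     ≤⟨ m≤m+n (a + d) k ⟩
  a + d + k ≡⟨ eq ⟩
  b + c     ≤⟨ +-monoʳ-≤ b c≤d ⟩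
  b + d     ∎)
  where open ≤-Reasoning

-- Zero forcing and propagation in an arbitrary graph

module _ {n : ℕ} (G : Graph n) where
  open Graph G

  step : Subset n → Subset n
  step S = S ∪ forceable G S

  ∈-step⁻ : ∀ {S v} → v ∈ step S → v ∈ S ⊎ ∃[ u ] CanForce G S u v
  ∈-step⁻ {S} {v} v∈ with x∈p∪q⁻ S (forceable G S) v∈
  ... | inj₁ v∈S = inj₁ v∈S
  ... | inj₂ v∈F with any? (λ u → canForce? G S u v)
                    | trans (sym (lookup∘tabulate (λ v → does (any? (λ u → canForce? G S u v))) v))
                            ([]=⇒lookup v∈F)
  ...   | yes f | _ = inj₂ f
  ...   | no _  | ()

  ∈-step⁺ : ∀ {S u v} → CanForce G S u v → v ∈ step S
  ∈-step⁺ {S} {u} {v} f = x∈p∪q⁺ (inj₂ (lookup⇒[]= v (forceable G S) (trans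
    (lookup∘tabulate (λ v → does (any? (λ u → canForce? G S u v))) v)
    (dec-true (any? (λ u → canForce? G S u v)) (u , f)))))

  ⊆-step : ∀ {S} → S ⊆ step S
  ⊆-step {S} = p⊆p∪q (forceable G S)

  step-force : ∀ {S u v} → u ∈ S → Adj u v → (∀ w → Adj u w → w ≢ v → w ∈ S) → v ∈ step S
  step-force {S} {u} {v} u∈S uv others with v ∈? S
  ... | yes v∈S = ⊆-step v∈S
  ... | no v∉S = ∈-step⁺ (u∈S , v∉S , uv , λ w uw w∉S →
    decidable-stable (w ≟ᶠ v) (λ w≢v → w∉S (others w uw w≢v)))

  force-others : ∀ {S u v w} → CanForce G S u v → Adj u w → w ≢ v → w ∈ S
  force-others {S} {w = w} (_ , _ , _ , only) uw w≢v =
    decidable-stable (w ∈? S) (λ w∉S → w≢v (only w uw w∉S))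

  ⟶*-trans : ∀ {S T U} → _⟶*_ G S T → _⟶*_ G T U → _⟶*_ G S U
  ⟶*-trans done          t = t
  ⟶*-trans (force u v f s) t = force u v f (⟶*-trans s t)

  -- A force of S stays available in a larger set until its target is blue.
  absorb : ∀ {S T} → S ⊆ T → (vs : List (Fin n)) →
           ∃[ U ] _⟶*_ G T U × T ⊆ U × (∀ {v} → v ∈ˡ vs → v ∈ step S → v ∈ U)
  absorb {S} {T} S⊆T [] = T , done , id , λ ()
  absorb {S} {T} S⊆T (x ∷ vs) with x ∈? T | x ∈? step S
  ... | yes x∈T | _ =
    let U , T⟶U , T⊆U , h = absorb S⊆T vs
    in U , T⟶U , T⊆U , λ { (here refl) _ → T⊆U x∈T ; (there v∈) → h v∈ }
  ... | no _ | no x∉ =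
    let U , T⟶U , T⊆U , h = absorb S⊆T vs
    in U , T⟶U , T⊆U , λ { (here refl) x∈ → contradiction x∈ x∉ ; (there v∈) → h v∈ }
  ... | no x∉T | yes x∈ with ∈-step⁻ x∈
  ...   | inj₁ x∈S = contradiction (S⊆T x∈S) x∉T
  ...   | inj₂ (u , u∈S , _ , ux , only) =
    let T⊆T∪x = p⊆p∪q ⁅ x ⁆
        U , T⟶U , T⊆U , h = absorb (T⊆T∪x ∘ S⊆T) vs
    in U
     , force u x (S⊆T u∈S , x∉T , ux , λ w uw w∉T → only w uw (w∉T ∘ S⊆T)) T⟶U
     , T⊆U ∘ T⊆T∪x
     , λ { (here refl) _ → T⊆U (x∈p∪q⁺ (inj₂ (x∈⁅x⁆ x))) ; (there v∈) → h v∈ }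

  ⟶*-blueAfter : ∀ B k → ∃[ T ] _⟶*_ G B T × blueAfter G B k ⊆ T
  ⟶*-blueAfter B zero = B , done , id
  ⟶*-blueAfter B (suc k) =
    let T , B⟶T , ⊆T = ⟶*-blueAfter B k
        U , T⟶U , _ , h = absorb ⊆T (allFin n)
    in U , ⟶*-trans B⟶T T⟶U , h (∈-allFin _)

  blueAfter≡⊤⇒ZeroForcing : ∀ {B} k → blueAfter G B k ≡ ⊤ → ZeroForcing G B
  blueAfter≡⊤⇒ZeroForcing {B} k eq =
    let T , B⟶T , ⊆T = ⟶*-blueAfter B k
    in subst (_⟶*_ G B) (⊆-antisym ⊆⊤ (λ {v} _ → ⊆T (subst (v ∈_) (sym eq) ∈⊤))) B⟶T

  blueAfter-mono : ∀ {B j k} → j ≤ k → blueAfter G B j ⊆ blueAfter G B k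
  blueAfter-mono {B} {j} j≤k = go (≤⇒≤′ j≤k)
    where
    go : ∀ {k} → j ≤′ k → blueAfter G B j ⊆ blueAfter G B k
    go (≤′-reflexive refl) = id
    go (≤′-step j≤k)       = ⊆-step ∘ go j≤k

  Closed : (Fin n → Set) → Set
  Closed K = ∀ {S} → (∀ {v} → v ∈ S → K v) → ∀ {u v} → CanForce G S u v → K v

  -- In the usual terminology the complement of `K` is a fort that `S` misses. Quantifying over all
  -- sets below `K` in `Closed` lets `K` be any predicate, decidable or not.
  Stuck : Subset n → Set₁
  Stuck S = Σ[ K ∈ (Fin n → Set) ] Closed K × ∃ (λ v → ¬ K v) × (∀ {v} → v ∈ S → K v)

  step-closed : ∀ {K S} → Closed K → (∀ {v} → v ∈ S → K v) → ∀ {v} → v ∈ step S → K v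
  step-closed closed S⊆K v∈ with ∈-step⁻ v∈
  ... | inj₁ v∈S     = S⊆K v∈S
  ... | inj₂ (u , f) = closed S⊆K f

  Stuck⇒¬ZeroForcing : ∀ {S} → Stuck S → ¬ ZeroForcing G S
  Stuck⇒¬ZeroForcing (K , closed , (v , ¬Kv) , ⊆K) = go ⊆K
    where
    go : ∀ {S} → (∀ {v} → v ∈ S → K v) → ¬ ZeroForcing G S
    go S⊆K done = ¬Kv (S⊆K ∈⊤)
    go {S} S⊆K (force u w f s) = go (λ x∈ → case x∈p∪q⁻ S ⁅ w ⁆ x∈ of λ
      { (inj₁ x∈S) → S⊆K x∈S
      ; (inj₂ x∈w) → subst K (sym (x∈⁅y⁆⇒x≡y w x∈w)) (closed S⊆K f) }) s

  -- A single witness settles both numbers: filling up in `k` steps makes `B` zero forcing, and with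
  -- the first hypothesis its size is then the zero forcing number.
  IsPropagationTime⁺ : ∀ {z k B} →
    (∀ B′ → ZeroForcing G B′ → z ≤ ∣ B′ ∣) →
    (∀ B′ → ∣ B′ ∣ ≤ z → ∀ j → blueAfter G B′ j ≡ ⊤ → k ≤ j) →
    ∣ B ∣ ≤ z → blueAfter G B k ≡ ⊤ → IsPropagationTime G k
  IsPropagationTime⁺ {z} {k} {B} z≤ fast ∣B∣≤z B-full =
    ( B , B-zf , ((B , B-zf , refl) , λ { _ (B′ , zf , refl) → ≤-trans ∣B∣≤z (z≤ B′ zf) })
    , B-full , fast B ∣B∣≤z )
    , λ { j (B′ , _ , (_ , least) , full , _) →
          fast B′ (≤-trans (least _ (B , B-zf , refl)) ∣B∣≤z) j full }
    where B-zf = blueAfter≡⊤⇒ZeroForcing k B-full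

-- Small subsets, multiples and a pigeonhole argument

∣p∪q∣≤∣p∣+∣q∣ : ∀ {n} (p q : Subset n) → ∣ p ∪ q ∣ ≤ ∣ p ∣ + ∣ q ∣
∣p∪q∣≤∣p∣+∣q∣ Vec.[]           Vec.[]           = z≤n
∣p∪q∣≤∣p∣+∣q∣ (true Vec.∷ p)   (true Vec.∷ q)   =
  s≤s (≤-trans (∣p∪q∣≤∣p∣+∣q∣ p q) (+-monoʳ-≤ ∣ p ∣ (n≤1+n ∣ q ∣)))
∣p∪q∣≤∣p∣+∣q∣ (true Vec.∷ p)   (false Vec.∷ q)  = s≤s (∣p∪q∣≤∣p∣+∣q∣ p q)
∣p∪q∣≤∣p∣+∣q∣ (false Vec.∷ p)  (true Vec.∷ q)   =
  subst (suc ∣ p ∪ q ∣ ≤_) (sym (+-suc ∣ p ∣ ∣ q ∣)) (s≤s (∣p∪q∣≤∣p∣+∣q∣ p q))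
∣p∪q∣≤∣p∣+∣q∣ (false Vec.∷ p)  (false Vec.∷ q)  = ∣p∪q∣≤∣p∣+∣q∣ p q

-- Padding with the default to length exactly `k` lets all sets of at most `k` vertices be treated
-- alike.
cover : ∀ {n k} {A : Set} (f : Fin n → A) → A → (B : Subset n) → ∣ B ∣ ≤ k →
        Σ[ xs ∈ Vec A k ] (∀ {v} → v ∈ B → f v ∈ᵛ xs)
cover f x Vec.[] _ = replicate _ x , λ ()
cover f x (false Vec.∷ B) ∣B∣≤k =
  let xs , h = cover (f ∘ suc) x B ∣B∣≤k
  in xs , λ { (there v∈) → h v∈ }
cover f x (true Vec.∷ B) (s≤s ∣B∣≤k) =
  let xs , h = cover (f ∘ suc) x B ∣B∣≤k
  in f zero Vec.∷ xs , λ { here → here refl ; (there v∈) → there (h v∈) }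

multiples-apart : ∀ {d x y} → d ∣ x → d ∣ y → x < y → d + x ≤ y
multiples-apart {d} {x} d∣x d∣y x<y with m≤n⇒∃[o]m+o≡n x<y
... | k , refl = lin 0
  (∣⇒≤ (∣m+n∣m⇒∣n (subst (d ∣_) (sym (+-suc x k)) d∣y) d∣x))
  (solve (d ∷ x ∷ k ∷ []))

pick : ∀ {n} {a b c : Fin n} → a ≢ b → a ≢ c → b ≢ c → ∀ x y →
       ∃[ v ] (v ≡ a ⊎ v ≡ b ⊎ v ≡ c) × v ≢ x × v ≢ y
pick {a = a} {b} {c} a≢b a≢c b≢c x y with a ≟ᶠ x | a ≟ᶠ y | b ≟ᶠ x | b ≟ᶠ y
... | no a≢x   | no a≢y   | _        | _        = a , inj₁ refl , a≢x , a≢y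
... | _        | _        | no b≢x   | no b≢y   = b , inj₂ (inj₁ refl) , b≢x , b≢y
... | yes refl | _        | yes refl | _        = contradiction refl a≢b
... | _        | yes refl | _        | yes refl = contradiction refl a≢b
... | yes refl | _        | _        | yes refl = c , inj₂ (inj₂ refl) , a≢c ∘ sym , b≢c ∘ sym
... | _        | yes refl | yes refl | _        = c , inj₂ (inj₂ refl) , b≢c ∘ sym , a≢c ∘ sym

-- Cycles with a hub: possible forces and closed sets

-- A cycle with vertices p i, indexed by ℕ with period n, whose vertices with
-- s ∣ suc i are joined to the hub zero.
record HubbedCycle {n : ℕ} (s : ℕ) (G : Graph (suc n)) : Set where
  open Graph G
  field
    2≤s          : 2 ≤ s
    s∣n          : s ∣ n
    3s≤n         : s + s + s ≤ n
    p            : ℕ → Fin (suc n)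
    p≢0          : ∀ {i} → p i ≢ zero
    p-shift      : ∀ i → p (n + i) ≡ p i
    p-distinct   : ∀ {i j} → i < j → j < n + i → p i ≢ p j
    p-index      : ∀ lo {v} → v ≢ zero → ∃[ i ] lo ≤ i × i < n + lo × v ≡ p i
    p-cong-suc   : ∀ {i j} → p i ≡ p j → p (suc i) ≡ p (suc j)
    p-cancel-suc : ∀ {i j} → p (suc i) ≡ p (suc j) → p i ≡ p j
    adj-suc      : ∀ i → Adj (p i) (p (suc i))
    adj-hub      : ∀ {i} → s ∣ suc i → Adj zero (p i)
    hub-spoke    : ∀ {i} → Adj zero (p i) → s ∣ suc i
    neighbour    : ∀ i {w} → Adj (p (suc i)) w →
                   w ≡ p i ⊎ w ≡ p (2 + i) ⊎ (w ≡ zero × s ∣ 2 + i)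

module Rim {n s : ℕ} {G : Graph (suc n)} (H : HubbedCycle s G) where
  open Graph G
  open HubbedCycle H

  Spoke : ℕ → Set
  Spoke i = s ∣ suc i

  6≤n : 6 ≤ n
  6≤n = ≤-trans (+-mono-≤ (+-mono-≤ 2≤s 2≤s) 2≤s) 3s≤n

  4+s≤n : 4 + s ≤ n
  4+s≤n = ≤-trans (+-monoˡ-≤ s (+-mono-≤ 2≤s 2≤s)) 3s≤n

  segment<n : ∀ i → s + suc i < n + i
  segment<n i = lin 2 4+s≤n (solve (s ∷ i ∷ n ∷ []))

  p-pred : ∀ i → ∃[ j ] p i ≡ p (suc j)
  p-pred i with p-index 1 (p≢0 {i})
  ... | suc j , _ , _ , eq = j , eq

  p-near : ∀ {i j d} → i ≤ j → j ≤ d + i → d < n → p i ≡ p j → i ≡ j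
  p-near {i} {j} {d} i≤j j≤d+i d<n eq with m≤n⇒m<n∨m≡n i≤j
  ... | inj₂ i≡j = i≡j
  ... | inj₁ i<j = contradiction eq (p-distinct i<j (≤-<-trans j≤d+i (+-monoˡ-< i d<n)))

  p≢p-suc : ∀ {i} → p i ≢ p (suc i)
  p≢p-suc {i} eq = case p-near {d = 1} (n≤1+n i) ≤-refl (≤-trans (s≤s (s≤s z≤n)) 6≤n) eq of λ ()

  p≢p-2+ : ∀ {i} → p i ≢ p (2 + i)
  p≢p-2+ {i} eq = case p-near {d = 2} (m≤n+m i 2) ≤-refl (≤-trans (s≤s (s≤s (s≤s z≤n))) 6≤n) eq of λ ()

  ¬consecutive-spokes : ∀ {i} → Spoke i → ¬ Spoke (suc i)
  ¬consecutive-spokes {i} a b = contradiction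
    (lin {3} {2} 0 (+-mono-≤ 2≤s (multiples-apart a b ≤-refl)) (solve (s ∷ i ∷ [])))
    λ { (s≤s (s≤s ())) }

  spokes-between : ∀ {a i} → Spoke a → Spoke i → a ≤ i → i ≤ s + a → i ≡ a ⊎ i ≡ s + a
  spokes-between {a} {i} sa si a≤i i≤ with m≤n⇒m<n∨m≡n a≤i
  ... | inj₂ a≡i = inj₁ (sym a≡i)
  ... | inj₁ a<i = inj₂ (≤-antisym i≤
    (lin 0 (multiples-apart sa si (s≤s a<i)) (solve (s ∷ i ∷ a ∷ []))))

  spoke-after : ∀ {i} → Spoke i → Spoke (s + i)
  spoke-after {i} si = subst (s ∣_) (+-suc s i) (∣m∣n⇒∣m+n ∣-refl si)

  -- The forcing vertex is `p (suc i)`, so that both of its rim neighbours have indices without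
  -- subtraction.
  data Force (S : Subset (suc n)) (i : ℕ) (v : Fin (suc n)) : Set where
    inward   : v ≡ zero → Spoke (suc i) → p i ∈ S → p (2 + i) ∈ S → Force S i v
    forward  : v ≡ p (2 + i) → p i ∈ S → (Spoke (suc i) → zero ∈ S) → Force S i v
    backward : v ≡ p i → p (2 + i) ∈ S → (Spoke (suc i) → zero ∈ S) → Force S i v

  rim-force : ∀ {S i v} → CanForce G S (p (suc i)) v → Force S i v
  rim-force {S} {i} f@(_ , _ , uv , _) with neighbour i uv
  ... | inj₁ refl = backward refl
    (force-others G f (adj-suc (suc i)) (p≢p-2+ ∘ sym))
    (λ si → force-others G f (symm (adj-hub si)) (p≢0 ∘ sym))
  ... | inj₂ (inj₁ refl) = forward refl
    (force-others G f (symm (adj-suc i)) p≢p-2+)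
    (λ si → force-others G f (symm (adj-hub si)) (p≢0 ∘ sym))
  ... | inj₂ (inj₂ (refl , si)) = inward refl si
    (force-others G f (symm (adj-suc i)) p≢0)
    (force-others G f (adj-suc (suc i)) p≢0)

  hub-force : ∀ {S v} → CanForce G S zero v →
              ∃[ j ] Spoke j × v ≡ p j × (∀ {i} → Spoke i → p i ≢ p j → p i ∈ S)
  hub-force {v = v} f@(_ , _ , uv , _) with p-index 0 {v} (λ { refl → irrefl refl uv })
  ... | j , _ , _ , refl = j , hub-spoke uv , refl , λ si i≢j → force-others G f (adj-hub si) i≢j

  Arc : ℕ → ℕ → Fin (suc n) → Set
  Arc lo hi v = ∃[ i ] lo ≤ i × i < hi × v ≡ p i

  Arc-shift : ∀ {lo hi v} → Arc lo hi v → Arc (n + lo) (n + hi) v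
  Arc-shift (i , lo≤i , i<hi , refl) =
    n + i , +-monoʳ-≤ n lo≤i , +-monoʳ-< n i<hi , sym (p-shift i)

  Arc-mono : ∀ {lo hi lo′ hi′ v} → lo′ ≤ lo → hi ≤ hi′ → Arc lo hi v → Arc lo′ hi′ v
  Arc-mono lo′≤ ≤hi′ (i , lo≤i , i<hi , eq) = i , ≤-trans lo′≤ lo≤i , <-≤-trans i<hi ≤hi′ , eq

  Arc-misses : ∀ {lo hi j} → hi ≤ j → j < n + lo → ¬ Arc lo hi (p j)
  Arc-misses hi≤j j<n+lo (i , lo≤i , i<hi , eq) =
    p-distinct (<-≤-trans i<hi hi≤j) (<-≤-trans j<n+lo (+-monoʳ-≤ n lo≤i)) (sym eq)

  Arc-neighbour : ∀ {lo hi u v} → Arc (suc lo) hi u → Adj u v → v ≡ zero ⊎ Arc lo (suc hi) v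
  Arc-neighbour {lo} (suc i , s≤s lo≤i , i<hi , refl) uv with neighbour i uv
  ... | inj₁ refl                = inj₂ (i , lo≤i , <-trans (n<1+n i) (m≤n⇒m≤1+n i<hi) , refl)
  ... | inj₂ (inj₁ refl)         = inj₂ (2 + i , m≤n⇒m≤1+n (m≤n⇒m≤1+n lo≤i) , s≤s i<hi , refl)
  ... | inj₂ (inj₂ (refl , _))   = inj₁ refl

  Isolated : (Fin (suc n) → Set) → Set
  Isolated K = ∀ i → K (p i) → ¬ K (p (suc i))

  -- Whatever a rim vertex forces, at least one of its two rim neighbours must already be blue.
  isolated-rim : ∀ {K S i v} → Isolated K → (∀ {w} → w ∈ S → K w) → ¬ CanForce G S (p i) v
  isolated-rim {i = i} iso S⊆K f with p-pred i
  ... | j , eq rewrite eq with rim-force f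
  ...   | inward _ _ j∈ _    = iso j (S⊆K j∈) (S⊆K (proj₁ f))
  ...   | forward _ j∈ _     = iso j (S⊆K j∈) (S⊆K (proj₁ f))
  ...   | backward _ 2+j∈ _  = iso (suc j) (S⊆K (proj₁ f)) (S⊆K 2+j∈)

  isolated-closed : ∀ {K} → Isolated K →
    (∀ {S} → (∀ {v} → v ∈ S → K v) → ∀ {v} → CanForce G S zero v → K v) → Closed G K
  isolated-closed iso hub S⊆K {u} f with u ≟ᶠ zero
  ... | yes refl = hub S⊆K f
  ... | no u≢0 with p-index 0 u≢0
  ...   | i , _ , _ , refl = contradiction f (isolated-rim iso S⊆K)

  -- The indices `s - 1`, `2 * s - 1` and `3 * s - 1` give distinct spoke vertices by `3s≤n`, and
  -- two exclusions cannot remove all three.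
  three-spokes : ∀ x y → ∃[ i ] Spoke i × p i ≢ x × p i ≢ y
  three-spokes x y with m≤n⇒∃[o]m+o≡n 2≤s
  ... | t , eq with pick
      (p-distinct {suc t} {s + suc t}
        (lin 1 2≤s (solve (s ∷ t ∷ []))) (lin 3 4+s≤n (solve (s ∷ t ∷ n ∷ []))))
      (p-distinct {suc t} {s + (s + suc t)}
        (lin 3 (+-mono-≤ 2≤s 2≤s) (solve (s ∷ t ∷ [])))
        (lin 1 (+-mono-≤ 3s≤n 2≤s) (solve (s ∷ t ∷ n ∷ []))))
      (p-distinct {s + suc t} {s + (s + suc t)}
        (lin 1 2≤s (solve (s ∷ t ∷ []))) (lin 3 4+s≤n (solve (s ∷ t ∷ n ∷ [])))) x y
  ...   | _ , inj₁ refl , ≢x , ≢y        = _ , ∣-reflexive (sym eq) , ≢x , ≢y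
  ...   | _ , inj₂ (inj₁ refl) , ≢x , ≢y = _ , spoke-after (∣-reflexive (sym eq)) , ≢x , ≢y
  ...   | _ , inj₂ (inj₂ refl) , ≢x , ≢y =
            _ , spoke-after (spoke-after (∣-reflexive (sym eq))) , ≢x , ≢y

  Spoke-cong : ∀ {i j} → p i ≡ p j → Spoke i → Spoke j
  Spoke-cong eq si = hub-spoke (subst (Adj zero) eq (adj-hub si))

  Triple : (a b c v : Fin (suc n)) → Set
  Triple a b c v = v ≡ a ⊎ v ≡ b ⊎ v ≡ c

  rotate : ∀ {a b c v} → Triple a b c v → Triple b c a v
  rotate (inj₁ e)        = inj₂ (inj₂ e)
  rotate (inj₂ (inj₁ e)) = inj₁ e
  rotate (inj₂ (inj₂ e)) = inj₂ (inj₁ e)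

  flip : ∀ {a b c v} → Triple a b c v → Triple a c b v
  flip (inj₁ e)        = inj₁ e
  flip (inj₂ (inj₁ e)) = inj₂ (inj₂ e)
  flip (inj₂ (inj₂ e)) = inj₂ (inj₁ e)

  Isolated-rotate : ∀ {a b c} → Isolated (Triple a b c) → Isolated (Triple c a b)
  Isolated-rotate iso i k k′ = iso i (rotate k) (rotate k′)

  Isolated-flip : ∀ {a b c} → Isolated (Triple a b c) → Isolated (Triple a c b)
  Isolated-flip iso i k k′ = iso i (flip k) (flip k′)

  HubStar : Fin (suc n) → Set
  HubStar v = v ≡ zero ⊎ Adj zero v

  HubStar-stuck : ∀ {S} → (∀ {v} → v ∈ S → HubStar v) → Stuck G S
  HubStar-stuck S⊆ = HubStar
    , isolated-closed isolated (λ _ f → inj₂ (proj₁ (proj₂ (proj₂ f))))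
    , (let i , si , _ = three-spokes zero zero
       in p (suc i) , λ { (inj₁ e) → p≢0 e ; (inj₂ e) → ¬consecutive-spokes si (hub-spoke e) })
    , S⊆
    where
    isolated : Isolated HubStar
    isolated i (inj₁ e) _        = p≢0 e
    isolated i _        (inj₁ e) = p≢0 e
    isolated i (inj₂ e) (inj₂ f) = ¬consecutive-spokes (hub-spoke e) (hub-spoke f)

  -- To force, the hub needs all but one of its neighbours blue, hence at least two, and only `c`
  -- can be one.
  isolated-hub-nonspoke-stuck : ∀ {S b c} → Isolated (Triple zero b c) → ¬ HubStar b →
    (∀ {v} → v ∈ S → Triple zero b c v) → Stuck G S
  isolated-hub-nonspoke-stuck {S} {b} {c} iso ¬b S⊆ = Triple zero b c
    , isolated-closed iso (λ {T} T⊆ {v} f →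
        let j , _ , v≡j , others = hub-force f
            i , si , i≢v , i≢c   = three-spokes v c
        in contradiction (T⊆ (others si (subst (p i ≢_) v≡j i≢v))) (missed si i≢c))
    , (let i , si , _ , i≢c = three-spokes c c in p i , missed si i≢c)
    , S⊆
    where
    missed : ∀ {i} → Spoke i → p i ≢ c → ¬ Triple zero b c (p i)
    missed si i≢c (inj₁ e)           = p≢0 e
    missed si i≢c (inj₂ (inj₁ refl)) = ¬b (inj₂ (adj-hub si))
    missed si i≢c (inj₂ (inj₂ e))    = i≢c e

  HubStar? : ∀ v → Dec (HubStar v)
  HubStar? v = v ≟ᶠ zero ⊎-dec adj? zero v

  isolated-hub-stuck : ∀ {S b c} → Isolated (Triple zero b c) →
    (∀ {v} → v ∈ S → Triple zero b c v) → Stuck G S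
  isolated-hub-stuck {b = b} {c} iso S⊆ with HubStar? b | HubStar? c
  ... | no ¬b | _     = isolated-hub-nonspoke-stuck iso ¬b S⊆
  ... | yes _ | no ¬c = isolated-hub-nonspoke-stuck (Isolated-flip iso) ¬c (flip ∘ S⊆)
  ... | yes hb | yes hc = HubStar-stuck λ v∈ → case S⊆ v∈ of λ
    { (inj₁ e) → inj₁ e ; (inj₂ (inj₁ refl)) → hb ; (inj₂ (inj₂ refl)) → hc }

  isolated-triple-stuck : ∀ {S a b c} → Isolated (Triple a b c) →
    (∀ {v} → v ∈ S → Triple a b c v) → Stuck G S
  isolated-triple-stuck {S} {a} {b} {c} iso S⊆ with a ≟ᶠ zero | b ≟ᶠ zero | c ≟ᶠ zero
  ... | yes refl | _ | _ = isolated-hub-stuck iso S⊆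
  ... | _ | yes refl | _ = isolated-hub-stuck (Isolated-rotate (Isolated-rotate iso)) (rotate ∘ S⊆)
  ... | _ | _ | yes refl = isolated-hub-stuck (Isolated-rotate iso) (rotate ∘ rotate ∘ S⊆)
  ... | no a≢ | no b≢ | no c≢ = Triple a b c
    , isolated-closed iso (λ T⊆ f → contradiction (T⊆ (proj₁ f)) ¬0)
    , (zero , ¬0)
    , S⊆
    where
    ¬0 : ¬ Triple a b c zero
    ¬0 (inj₁ e)        = a≢ (sym e)
    ¬0 (inj₂ (inj₁ e)) = b≢ (sym e)
    ¬0 (inj₂ (inj₂ e)) = c≢ (sym e)

  -- The range from `lo` to `hi` may run past the spoke vertices `suc a` and `s + suc a`; it then
  -- goes on counting steps while the blue part stays clipped.
  Segment : (a lo hi : ℕ) → Fin (suc n) → Set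
  Segment a lo hi v = ∃[ i ] suc a ≤ i × i ≤ s + suc a × lo ≤ i × i < hi × v ≡ p i

  -- The blue vertices p i with lo ≤ i < hi lie between consecutive spokes, so no
  -- force leaves the segment unless the further vertex d is adjacent to them.
  segment-force : ∀ {S a lo hi d} → Spoke (suc a) →
    (∀ {v} → v ∈ S → Segment a lo hi v ⊎ v ≡ d) →
    d ≢ zero → (lo ≤ suc a → d ≢ p a) → (∀ {j} → j ≡ s + suc a → j < hi → d ≢ p (suc j)) →
    d ≢ p hi → d ≢ p (pred lo) →
    ∀ {u v} → CanForce G S u v → Segment a (pred lo) (suc hi) v
  segment-force {S} {a} {lo} {hi} {d} sa S⊆ d≢0 c₁ c₂ c₃ c₄ {u} {v} f = case S⊆ (proj₁ f) of λ
    { (inj₁ seg) → from-segment seg f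
    ; (inj₂ refl) → from-d f }
    where
    0∉S : zero ∉ S
    0∉S 0∈ with S⊆ 0∈
    ... | inj₁ (_ , _ , _ , _ , _ , e) = p≢0 (sym e)
    ... | inj₂ e = d≢0 (sym e)

    from-segment : ∀ {u} → Segment a lo hi u → CanForce G S u v → Segment a (pred lo) (suc hi) v
    from-segment (suc i , s≤s a≤i , i≤ , lo≤i , i<hi , refl) f with rim-force f
    ... | forward refl _ hub = 2 + i , m≤n⇒m≤1+n (s≤s a≤i)
        , ≤∧≢⇒< i≤ (λ e → 0∉S (hub (subst Spoke (sym e) (spoke-after sa))))
        , ≤-trans pred[n]≤n (m≤n⇒m≤1+n lo≤i) , s≤s i<hi , refl
    ... | backward refl _ hub = i
        , ≤∧≢⇒< a≤i (λ { refl → 0∉S (hub sa) })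
        , ≤-trans (n≤1+n i) i≤ , pred-mono-≤ lo≤i , ≤-trans (n<1+n i) (≤-trans (<⇒≤ i<hi) (n≤1+n hi)) , refl
    -- Forcing the hub from an end of the segment takes a blue vertex just outside it. That could
    -- only be `d`, which `c₁` and `c₂` exclude.
    ... | inward _ si i∈ 2+i∈ with spokes-between sa si (s≤s a≤i) i≤
    ...   | inj₁ refl with S⊆ i∈
    ...     | inj₂ e = contradiction (sym e) (c₁ lo≤i)
    ...     | inj₁ (j , a<j , j≤ , _ , _ , e) =
                contradiction e (p-distinct a<j (≤-<-trans j≤ (segment<n i)))
    from-segment (suc i , s≤s a≤i , i≤ , lo≤i , i<hi , refl) f
        | inward _ si i∈ 2+i∈ | inj₂ i≡ with S⊆ 2+i∈
    ...     | inj₂ e = contradiction (sym e) (c₂ i≡ i<hi)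
    ...     | inj₁ (j , a<j , j≤ , _ , _ , e) =
                contradiction (sym e) (p-distinct {j} {2 + i}
                  (s≤s (≤-trans j≤ (≤-reflexive (sym i≡))))
                  (≤-trans (≤-reflexive (cong suc (trans (cong suc i≡) (sym (+-suc s (suc a))))))
                           (≤-trans (segment<n (suc a)) (+-monoʳ-≤ n a<j))))

    successor-in : ∀ {i} → d ≡ p (suc i) → p i ∈ S → Segment a lo hi d
    successor-in {i} d≡ i∈ with S⊆ i∈
    ... | inj₂ e = contradiction (trans e d≡) p≢p-suc
    ... | inj₁ (j , a<j , j≤ , lo≤j , j<hi , e) =
        suc j , m≤n⇒m≤1+n a<j
      , ≤∧≢⇒< j≤ (λ j≡ → c₂ j≡ j<hi d≡j)
      , m≤n⇒m≤1+n lo≤j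
      , ≤∧≢⇒< j<hi (λ { refl → c₃ d≡j })
      , d≡j
      where d≡j = trans d≡ (p-cong-suc e)

    predecessor-in : ∀ {i} → d ≡ p (suc i) → p (2 + i) ∈ S → Segment a lo hi d
    predecessor-in {i} d≡ i∈ with S⊆ i∈
    ... | inj₂ e = contradiction (trans (sym d≡) (sym e)) p≢p-suc
    ... | inj₁ (suc j , s≤s a≤j , j≤ , lo≤j , j<hi , e) =
        j
      , ≤∧≢⇒< a≤j (λ { refl → c₁ lo≤j d≡j })
      , ≤-trans (n≤1+n j) j≤
      , s≤s⁻¹ (≤∧≢⇒< lo≤j (λ { refl → c₄ d≡j }))
      , ≤-trans (n<1+n j) (<⇒≤ j<hi)
      , d≡j
      where d≡j = trans d≡ (p-cancel-suc e)

    -- To force, `d` needs a blue rim neighbour in the segment; not being next to the segment from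
    -- outside, `d` then lies in it.
    from-d : CanForce G S d v → Segment a (pred lo) (suc hi) v
    from-d f with p-index 1 d≢0
    ... | suc i , _ , _ , d≡ with rim-force (subst (λ u → CanForce G S u v) d≡ f)
    ...   | inward _ _ i∈ _    = from-segment (successor-in d≡ i∈) f
    ...   | forward _ i∈ _     = from-segment (successor-in d≡ i∈) f
    ...   | backward _ 2+i∈ _  = from-segment (predecessor-in d≡ 2+i∈) f

-- Upper estimates for the blue set, step by step

module LowerBound {n s : ℕ} {G : Graph (suc n)} (H : HubbedCycle s G) where
  open Graph G
  open HubbedCycle H
  open Rim H

  -- An upper estimate of the blue vertices while the blue part of the rim is an
  -- arc; the bounds on hi ∸ lo make n ≤ suc N when everything is blue.
  data Within (N : ℕ) (S : Subset (suc n)) : Set₁ where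
    stuck : Stuck G S → Within N S
    segment : ∀ a lo hi d → d ≢ zero → Spoke (suc a) →
      lo ≤ s + suc a → suc a < hi → lo ≤ hi → hi < N + lo →
      (∀ {v} → v ∈ S → Segment a lo hi v ⊎ v ≡ d) → Within N S
    arc : ∀ lo hi → hi ≤ N + lo →
      (∀ {v} → v ∈ S → v ≡ zero ⊎ Arc lo hi v) → Within N S
    -- The hub can have forced only the last white spoke vertex, d.
    arc+ : ∀ lo hi d → hi ≤ N + lo → (∀ {i} → Spoke i → Arc lo hi (p i) ⊎ p i ≡ d) →
      (∀ {v} → v ∈ S → v ≡ zero ⊎ Arc lo hi v ⊎ v ≡ d) → Within N S
    spoked-arc : ∀ lo hi → hi ≤ suc N + lo → (∀ {i} → Spoke i → Arc lo hi (p i)) →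
      (∀ {v} → v ∈ S → v ≡ zero ⊎ Arc lo hi v) → Within N S

  -- Moving an arc by a full turn, to make room below its first index.
  turn : ∀ {N} (P : ℕ → ℕ → Set₁) lo hi → hi ≤ N + lo →
    (∀ lo hi → hi ≤ N + suc lo → P (suc lo) hi) →
    (P (n + lo) (n + hi) → P lo hi) → P lo hi
  turn P (suc lo) hi h f _ = f lo hi h
  turn {N} P zero hi h f back with m≤n⇒∃[o]m+o≡n 6≤n
  ... | t , eq = back (subst (λ x → P x (n + hi)) (trans eq (sym (+-identityʳ n)))
    (f (5 + t) (n + hi) (lin 0 (+-mono-≤ h (≤-reflexive (sym eq))) (solve (n ∷ hi ∷ N ∷ t ∷ [])))))

  Arc-step : ∀ {S u v lo hi} → Arc (suc lo) hi u → CanForce G S u v → v ≡ zero ⊎ Arc lo (suc hi) v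
  Arc-step u∈ (_ , _ , uv , _) = Arc-neighbour u∈ uv

  Arc-widen : ∀ {lo hi v} → Arc (suc lo) hi v → Arc lo (suc hi) v
  Arc-widen = Arc-mono (n≤1+n _) (n≤1+n _)

  widen-bound : ∀ {N lo hi} → hi ≤ N + suc lo → suc hi ≤ 2 + N + lo
  widen-bound {N} {lo} {hi} h = lin 0 h (solve (N ∷ lo ∷ hi ∷ []))

  -- All neighbours of the hub lie in the arc, so a hub force adds nothing and only the two ends
  -- move.
  spoked-arc-step : ∀ {N S lo hi} → hi ≤ suc N + lo → (∀ {i} → Spoke i → Arc lo hi (p i)) →
    (∀ {v} → v ∈ S → v ≡ zero ⊎ Arc lo hi v) → Within (2 + N) (step G S)
  spoked-arc-step {N} {S} {lo} {hi} h = turn {suc N} P lo hi h base back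
    where
    P : ℕ → ℕ → Set₁
    P lo hi = (∀ {i} → Spoke i → Arc lo hi (p i)) →
      (∀ {v} → v ∈ S → v ≡ zero ⊎ Arc lo hi v) → Within (2 + N) (step G S)
    back : ∀ {lo hi} → P (n + lo) (n + hi) → P lo hi
    back f spokes S⊆ = f (Arc-shift ∘ spokes) (λ v∈ → Sum.map₂ Arc-shift (S⊆ v∈))
    base : ∀ lo hi → hi ≤ suc N + suc lo → P (suc lo) hi
    base lo hi h spokes S⊆ = spoked-arc lo (suc hi) (widen-bound {suc N} h) (Arc-widen ∘ spokes)
      λ v∈ → case ∈-step⁻ G v∈ of λ
        { (inj₁ v∈S) → Sum.map₂ Arc-widen (S⊆ v∈S)
        ; (inj₂ (u , f)) → case S⊆ (proj₁ f) of λ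
          { (inj₂ u∈) → Arc-step u∈ f
          ; (inj₁ refl) → case hub-force f of λ
            { (j , sj , refl , _) → inj₂ (Arc-widen (spokes sj)) } } }

  -- A hub force on `w` shows that every other spoke vertex is blue, hence in the arc. This is what
  -- `arc+` remembers, and it keeps the hub from contributing a second vertex later.
  arc-step : ∀ {N S lo hi} → hi ≤ N + lo →
    (∀ {v} → v ∈ S → v ≡ zero ⊎ Arc lo hi v) → Within (2 + N) (step G S)
  arc-step {N} {S} {lo} {hi} h = turn {N} P lo hi h base back
    where
    P : ℕ → ℕ → Set₁
    P lo hi = (∀ {v} → v ∈ S → v ≡ zero ⊎ Arc lo hi v) → Within (2 + N) (step G S)
    back : ∀ {lo hi} → P (n + lo) (n + hi) → P lo hi
    back f S⊆ = f (λ v∈ → Sum.map₂ Arc-shift (S⊆ v∈))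
    base : ∀ lo hi → hi ≤ N + suc lo → P (suc lo) hi
    base lo hi h S⊆ with any? (λ v → canForce? G S zero v)
    ... | no ¬f = arc lo (suc hi) (widen-bound {N} h)
      λ v∈ → case ∈-step⁻ G v∈ of λ
        { (inj₁ v∈S) → Sum.map₂ Arc-widen (S⊆ v∈S)
        ; (inj₂ (u , f)) → case S⊆ (proj₁ f) of λ
          { (inj₂ u∈) → Arc-step u∈ f
          ; (inj₁ refl) → contradiction (_ , f) ¬f } }
    ... | yes (w , hub) = arc+ lo (suc hi) w (widen-bound {N} h) spokes
      λ {v} v∈ → case ∈-step⁻ G v∈ of λ
        { (inj₁ v∈S) → Sum.map₂ (inj₁ ∘ Arc-widen) (S⊆ v∈S)
        ; (inj₂ (u , f)) → case S⊆ (proj₁ f) of λ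
          { (inj₂ u∈) → Sum.map₂ inj₁ (Arc-step u∈ f)
          ; (inj₁ refl) → inj₂ (spokes′ v f) } }
      where
      spokes : ∀ {i} → Spoke i → Arc lo (suc hi) (p i) ⊎ p i ≡ w
      spokes {i} si with p i ≟ᶠ w
      ... | yes e = inj₂ e
      ... | no ≢w with hub-force hub
      ...   | _ , _ , refl , others with S⊆ (others si ≢w)
      ...     | inj₁ e  = contradiction e p≢0
      ...     | inj₂ in-arc = inj₁ (Arc-widen in-arc)
      spokes′ : ∀ v → CanForce G S zero v → Arc lo (suc hi) v ⊎ v ≡ w
      spokes′ v f with hub-force f
      ... | _ , sj , refl , _ = spokes sj

  isolated-force : ∀ {S d lo hi v} → (∀ {w} → w ∈ S → w ≡ zero ⊎ Arc (suc lo) hi w ⊎ w ≡ d) →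
    d ≢ zero → d ≢ p hi → d ≢ p lo → CanForce G S d v → v ≡ zero ⊎ Arc lo (suc hi) v
  isolated-force {S} {d} {lo} {hi} S⊆ d≢0 ≢hi ≢lo f with p-index 1 d≢0
  ... | suc c , _ , _ , refl = case rim-force f of λ
    { (inward _ _ c∈ _)    → Arc-step (after c∈) f
    ; (forward _ c∈ _)     → Arc-step (after c∈) f
    ; (backward _ 2+c∈ _)  → Arc-step (before 2+c∈) f }
    where
    after : p c ∈ S → Arc (suc lo) hi d
    after c∈ with S⊆ c∈
    ... | inj₁ e = contradiction e p≢0
    ... | inj₂ (inj₂ e) = contradiction e p≢p-suc
    ... | inj₂ (inj₁ (j , lo<j , j<hi , e)) =
      suc j , m≤n⇒m≤1+n lo<j , ≤∧≢⇒< j<hi (λ { refl → ≢hi (p-cong-suc e) }) , p-cong-suc e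
    before : p (2 + c) ∈ S → Arc (suc lo) hi d
    before c∈ with S⊆ c∈
    ... | inj₁ e = contradiction e p≢0
    ... | inj₂ (inj₂ e) = contradiction (sym e) p≢p-suc
    ... | inj₂ (inj₁ (suc j , s≤s lo≤j , j<hi , e)) =
      j , ≤∧≢⇒< lo≤j (λ { refl → ≢lo (p-cancel-suc e) }) , <⇒≤ j<hi , p-cancel-suc e

  -- Once `d` is next to the arc it is absorbed, which lengthens the arc by one; the bound `suc N`
  -- of `spoked-arc` makes room for this.
  arc+-step : ∀ {N S lo hi d} → hi ≤ N + lo → (∀ {i} → Spoke i → Arc lo hi (p i) ⊎ p i ≡ d) →
    (∀ {v} → v ∈ S → v ≡ zero ⊎ Arc lo hi v ⊎ v ≡ d) → Within (2 + N) (step G S)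
  arc+-step {N} {S} {lo} {hi} {d} h = turn {N} P lo hi h base back
    where
    P : ℕ → ℕ → Set₁
    P lo hi = (∀ {i} → Spoke i → Arc lo hi (p i) ⊎ p i ≡ d) →
      (∀ {v} → v ∈ S → v ≡ zero ⊎ Arc lo hi v ⊎ v ≡ d) → Within (2 + N) (step G S)
    back : ∀ {lo hi} → P (n + lo) (n + hi) → P lo hi
    back f spokes S⊆ = f (λ si → Sum.map₁ Arc-shift (spokes si))
                         (λ v∈ → Sum.map₂ (Sum.map₁ Arc-shift) (S⊆ v∈))
    absorbed : ∀ {lo hi lo′ hi′} → hi′ ≤ suc N + lo′ → lo′ ≤ lo → hi ≤ hi′ → Arc lo′ hi′ d → P lo hi
    absorbed {lo} {hi} {lo′} {hi′} h′ ≤lo hi≤ d∈ spokes S⊆ = spoked-arc-step h′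
      (λ si → merge (spokes si))
      (λ v∈ → Sum.map₂ merge (S⊆ v∈))
      where
      merge : ∀ {v} → Arc lo hi v ⊎ v ≡ d → Arc lo′ hi′ v
      merge (inj₁ v∈)   = Arc-mono ≤lo hi≤ v∈
      merge (inj₂ refl) = d∈
    base : ∀ lo hi → hi ≤ N + suc lo → P (suc lo) hi
    base lo hi h with d ≟ᶠ p hi | d ≟ᶠ p lo
    -- The arc may be empty; the new arc then consists of `d` alone.
    ... | yes refl | _ = case ≤-total (suc lo) hi of λ
      { (inj₁ lo<hi) → absorbed (s≤s h) ≤-refl (n≤1+n hi) (hi , lo<hi , ≤-refl , refl)
      ; (inj₂ hi≤lo) → absorbed {lo′ = hi} (s≤s (m≤n+m hi N)) hi≤lo (n≤1+n hi) (hi , ≤-refl , ≤-refl , refl) }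
    ... | no _ | yes refl = case ≤-total (suc lo) hi of λ
      { (inj₁ lo<hi) → absorbed (≤-trans h (≤-reflexive (+-suc N lo))) (n≤1+n lo) ≤-refl (lo , ≤-refl , lo<hi , refl)
      ; (inj₂ hi≤lo) → absorbed {lo′ = lo} (s≤s (m≤n+m lo N)) (n≤1+n lo) hi≤lo (lo , ≤-refl , ≤-refl , refl) }
    ... | no ≢hi | no ≢lo = λ spokes S⊆ →
        arc+ lo (suc hi) d (widen-bound {N} h) (λ si → Sum.map₁ Arc-widen (spokes si))
        λ {v} v∈ → case ∈-step⁻ G v∈ of λ
        { (inj₁ v∈S) → Sum.map₂ (Sum.map₁ Arc-widen) (S⊆ v∈S)
        ; (inj₂ (u , f)) → case u ≟ᶠ zero of λ
          { (yes refl) → case hub-force f of λ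
            { (j , sj , refl , _) → inj₂ (Sum.map₁ Arc-widen (spokes sj)) }
          ; (no u≢0) → case S⊆ (proj₁ f) of λ
            { (inj₁ refl) → contradiction refl u≢0
            ; (inj₂ (inj₁ u∈)) → Sum.map₂ inj₁ (Arc-step u∈ f)
            ; (inj₂ (inj₂ refl)) → Sum.map₂ inj₁ (isolated-force S⊆ u≢0 ≢hi ≢lo f) } } }

  pred-bound : ∀ {N hi} lo → hi < N + lo → hi ≤ N + pred lo
  pred-bound zero h = <⇒≤ h
  pred-bound {N} (suc lo) h = s≤s⁻¹ (≤-trans h (≤-reflexive (+-suc N lo)))

  -- The strict bound on `hi` reserves a place for `d`. When `d` is next to the segment, both fit
  -- into an arc bounded by `N`, and `arc-step` takes over.
  segment-step : ∀ {N S a lo hi d} → d ≢ zero → Spoke (suc a) →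
    lo ≤ s + suc a → suc a < hi → lo ≤ hi → hi < N + lo →
    (∀ {v} → v ∈ S → Segment a lo hi v ⊎ v ≡ d) → Within (2 + N) (step G S)
  segment-step {N} {S} {a} {lo} {hi} {d} d≢0 sa lo≤ <hi lo≤hi hi< S⊆
    with lo ≤? suc a ×-dec d ≟ᶠ p a
       | s + suc a <? hi ×-dec d ≟ᶠ p (suc (s + suc a))
       | d ≟ᶠ p hi
       | d ≟ᶠ p (pred lo)
  ... | yes (lo≤a , refl) | _ | _ | _ = arc-step {N} {lo = a} {hi} below λ v∈ → inj₂ (case S⊆ v∈ of λ
    { (inj₁ (i , a<i , _ , _ , i<hi , eq)) → i , <⇒≤ a<i , i<hi , eq
    ; (inj₂ refl) → a , ≤-refl , <⇒≤ <hi , refl })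
    where
    below : hi ≤ N + a
    below = s≤s⁻¹ (≤-trans hi< (≤-trans (+-monoʳ-≤ N lo≤a) (≤-reflexive (+-suc N a))))
  ... | _ | yes (<hi′ , refl) | _ | _ = arc-step {N} {lo = lo} {suc hi} hi< λ v∈ → inj₂ (case S⊆ v∈ of λ
    { (inj₁ (i , _ , _ , lo≤i , i<hi , eq)) → i , lo≤i , m≤n⇒m≤1+n i<hi , eq
    ; (inj₂ refl) → _ , m≤n⇒m≤1+n lo≤ , s≤s <hi′ , refl })
  ... | _ | _ | yes refl | _ = arc-step {N} {lo = lo} {suc hi} hi< λ v∈ → inj₂ (case S⊆ v∈ of λ
    { (inj₁ (i , _ , _ , lo≤i , i<hi , eq)) → i , lo≤i , m≤n⇒m≤1+n i<hi , eq
    ; (inj₂ refl) → hi , lo≤hi , ≤-refl , refl })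
  ... | _ | _ | _ | yes refl = arc-step {N} {lo = pred lo} {hi} (pred-bound lo hi<) λ v∈ → inj₂ (case S⊆ v∈ of λ
    { (inj₁ (i , _ , _ , lo≤i , i<hi , eq)) → i , ≤-trans pred[n]≤n lo≤i , i<hi , eq
    ; (inj₂ refl) → pred lo , ≤-refl , pred-< lo lo≤hi , refl })
    where
    pred-< : ∀ lo → lo ≤ hi → pred lo < hi
    pred-< zero     _     = ≤-trans (s≤s z≤n) <hi
    pred-< (suc lo) lo<hi = lo<hi
  ... | no c₁ | no c₂ | no c₃ | no c₄ = segment a (pred lo) (suc hi) d d≢0 sa
    (≤-trans pred[n]≤n lo≤) (m≤n⇒m≤1+n <hi) (≤-trans pred[n]≤n (m≤n⇒m≤1+n lo≤hi)) (s≤s (s≤s (pred-bound lo hi<)))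
    λ v∈ → case ∈-step⁻ G v∈ of λ
    { (inj₁ v∈S) → Sum.map₁ widen (S⊆ v∈S)
    ; (inj₂ (u , f)) → inj₁ (segment-force sa S⊆ d≢0
        (λ lo≤a e → c₁ (lo≤a , e))
        (λ { refl <hi e → c₂ (<hi , e) })
        c₃ c₄ f) }
    where
    widen : ∀ {v} → Segment a lo hi v → Segment a (pred lo) (suc hi) v
    widen (i , a<i , i≤ , lo≤i , i<hi , eq) =
      i , a<i , i≤ , ≤-trans pred[n]≤n lo≤i , m≤n⇒m≤1+n i<hi , eq

  Within-step : ∀ {N S} → Within N S → Within (2 + N) (step G S)
  Within-step (stuck (K , closed , proper , S⊆)) = stuck (K , closed , proper , step-closed G closed S⊆)
  Within-step (segment a lo hi d d≢0 sa lo≤ <hi lo≤hi hi< S⊆) =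
    segment-step d≢0 sa lo≤ <hi lo≤hi hi< S⊆
  Within-step (arc lo hi h S⊆) = arc-step h S⊆
  Within-step (arc+ lo hi d h spokes S⊆) = arc+-step h spokes S⊆
  Within-step (spoked-arc lo hi h spokes S⊆) = spoked-arc-step h spokes S⊆

  Within-blueAfter : ∀ {N B} → Within N B → ∀ k → Within (k * 2 + N) (blueAfter G B k)
  Within-blueAfter w zero    = w
  Within-blueAfter w (suc k) = Within-step (Within-blueAfter w k)

  arc-full : ∀ {lo hi d} → (∀ {v} → v ≡ zero ⊎ Arc lo hi v ⊎ v ≡ d) → n + lo ≤ suc hi
  arc-full {lo} {hi} {d} all = ≮⇒≥ λ <n → case all {p hi} of λ
    { (inj₁ e) → p≢0 e
    ; (inj₂ (inj₁ in-arc)) → Arc-misses ≤-refl (<⇒≤ <n) in-arc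
    ; (inj₂ (inj₂ refl)) → case all {p (suc hi)} of λ
      { (inj₁ e) → p≢0 e
      ; (inj₂ (inj₁ in-arc)) → Arc-misses (n≤1+n hi) <n in-arc
      ; (inj₂ (inj₂ e)) → p≢p-suc (sym e) } }

  arc-full′ : ∀ {lo hi} → (∀ {v} → v ≡ zero ⊎ Arc lo hi v) → n + lo ≤ hi
  arc-full′ {lo} {hi} all = ≮⇒≥ λ <n → case all {p hi} of λ
    { (inj₁ e) → p≢0 e
    ; (inj₂ in-arc) → Arc-misses ≤-refl <n in-arc }

  Within-full : ∀ {N S} → Within N S → S ≡ ⊤ → n ≤ suc N
  Within-full (stuck (K , _ , (v , ¬Kv) , S⊆)) refl = contradiction (S⊆ ∈⊤) ¬Kv
  Within-full (segment a lo hi d d≢0 _ _ _ _ _ S⊆) refl with S⊆ {zero} ∈⊤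
  ... | inj₁ (_ , _ , _ , _ , _ , e) = contradiction (sym e) p≢0
  ... | inj₂ e = contradiction (sym e) d≢0
  Within-full {N} (arc lo hi h S⊆) refl = +-cancelʳ-≤ lo n (suc N)
    (≤-trans (arc-full′ (S⊆ ∈⊤)) (m≤n⇒m≤1+n h))
  Within-full {N} (arc+ lo hi d h _ S⊆) refl = +-cancelʳ-≤ lo n (suc N)
    (≤-trans (arc-full (S⊆ ∈⊤)) (s≤s h))
  Within-full {N} (spoked-arc lo hi h _ S⊆) refl = +-cancelʳ-≤ lo n (suc N)
    (≤-trans (arc-full′ (S⊆ ∈⊤)) h)

-- Initial sets of two and three vertices

quotient-large : ∀ {n i s r q} → 4 + s ≤ n → r < s → suc (n + i) ≡ r + q → 2 ≤ q
quotient-large {n} {i} {s} {r} {q} s≤n r<s eq = ≤-trans (s≤s (s≤s z≤n)) (+-cancelʳ-≤ s 4 q (begin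
  4 + s       ≤⟨ s≤n ⟩
  n           ≤⟨ m≤m+n n i ⟩
  n + i       ≤⟨ n≤1+n (n + i) ⟩
  suc (n + i) ≡⟨ eq ⟩
  r + q       ≤⟨ +-monoˡ-≤ q (<⇒≤ r<s) ⟩
  s + q       ≡⟨ +-comm s q ⟩
  q + s       ∎))
  where open ≤-Reasoning

remainder-small : ∀ {n i s r a} → r < s → suc (n + i) ≡ r + (2 + a) → n + i < s + suc a
remainder-small {n} {i} {s} {r} {a} r<s eq = s≤s⁻¹ (begin
  2 + (n + i)     ≡⟨ cong suc eq ⟩
  suc r + (2 + a) ≤⟨ +-monoˡ-≤ (2 + a) r<s ⟩
  s + (2 + a)     ≡⟨ +-suc s (suc a) ⟩
  suc (s + suc a) ∎)
  where open ≤-Reasoning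

module Starts {n s : ℕ} {G : Graph (suc n)} (H : HubbedCycle s G) where
  open Graph G
  open HubbedCycle H
  open Rim H
  open LowerBound H

  private
    V = Fin (suc n)

  -- Adding a full turn puts the last spoke vertex at or before `p i` at a positive index, which
  -- leaves an index `a` below it.
  locate : ∀ i → ∃₂ λ j a → p i ≡ p j × Spoke (suc a) × suc a ≤ j × j < s + suc a
  locate i = from (m≤n⇒∃[o]m+o≡n
      (quotient-large {n} {i} {s} {r} {q * s} 4+s≤n (m%n<n (suc (n + i)) s) division))
    where
    instance
      s≢0 : NonZero s
      s≢0 = >-nonZero (<⇒≤ 2≤s)
    q = suc (n + i) / s
    r = suc (n + i) % s
    division : suc (n + i) ≡ r + q * s
    division = m≡m%n+[m/n]*n (suc (n + i)) s
    from : ∃[ a ] 2 + a ≡ q * s → ∃₂ λ j a → p i ≡ p j × Spoke (suc a) × suc a ≤ j × j < s + suc a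
    from (a , eq) = n + i , a , sym (p-shift i) , divides q eq
      , s≤s⁻¹ (≤-trans (≤-reflexive eq) (≤-trans (m≤n+m (q * s) r) (≤-reflexive (sym division))))
      , remainder-small {n} {i} {s} {r} {a} (m%n<n (suc (n + i)) s) (trans division (cong (r +_) (sym eq)))

  segment-stuck : ∀ {S a} → Spoke (suc a) →
    (∀ {v} → v ∈ S → ∃[ i ] suc a ≤ i × i ≤ s + suc a × v ≡ p i) → Stuck G S
  segment-stuck {S} {a} sa S⊆ = (λ v → ∃[ i ] suc a ≤ i × i ≤ s + suc a × v ≡ p i)
    , (λ {T} T⊆ f →
        -- The first spoke vertex of the segment stands in for the further vertex, so the blue set
        -- stays in the segment.
        let i , a<i , i≤ , _ , _ , eq = segment-force {T} {a} {suc a} {suc (s + suc a)} {p (suc a)} sa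
              (λ v∈ → let i , a<i , i≤ , eq = T⊆ v∈ in inj₁ (i , a<i , i≤ , a<i , s≤s i≤ , eq))
              p≢0 (λ _ → p≢p-suc ∘ sym) (λ { refl _ → p≢end }) p≢end (p≢p-suc ∘ sym) f
        in i , a<i , i≤ , eq)
    , (p a , λ (i , a<i , i≤ , eq) → p-distinct a<i (≤-<-trans i≤ (segment<n a)) eq)
    , S⊆
    where
    p≢end : p (suc a) ≢ p (suc (s + suc a))
    p≢end = p-distinct (s≤s (m≤n+m (suc a) s))
      (subst (_< n + suc a) (+-suc s (suc a)) (segment<n (suc a)))

  Triple? : ∀ a b c v → Dec (Triple a b c v)
  Triple? a b c v = v ≟ᶠ a ⊎-dec v ≟ᶠ b ⊎-dec v ≟ᶠ c

  isolated-or-adjacent : ∀ a b c →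
    Isolated (Triple a b c) ⊎ ∃[ t ] Triple a b c (p t) × Triple a b c (p (suc t))
  isolated-or-adjacent a b c
    with anyUpTo? (λ t → Triple? a b c (p t) ×-dec Triple? a b c (p (suc t))) (n + 0)
  ... | yes (t , _ , k , k′) = inj₂ (t , k , k′)
  ... | no none = inj₁ λ i k k′ →
    let t , _ , t<n , eq = p-index 0 (p≢0 {i})
    in none (t , t<n , subst (Triple a b c) eq k , subst (Triple a b c) (p-cong-suc eq) k′)

  adjacent-pair : ∀ {a b t} → Triple a b b (p t) → Triple a b b (p (suc t)) →
    ∀ {v} → Triple a b b v → v ≡ p t ⊎ v ≡ p (suc t)
  adjacent-pair k k′ j = go (two k) (two k′) (two j)
    where
    two : ∀ {a b v : V} → Triple a b b v → v ≡ a ⊎ v ≡ b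
    two (inj₁ e)        = inj₁ e
    two (inj₂ (inj₁ e)) = inj₂ e
    two (inj₂ (inj₂ e)) = inj₂ e
    go : ∀ {a b v : V} {t} → p t ≡ a ⊎ p t ≡ b → p (suc t) ≡ a ⊎ p (suc t) ≡ b →
         v ≡ a ⊎ v ≡ b → v ≡ p t ⊎ v ≡ p (suc t)
    go (inj₁ e)    (inj₁ e′)   _ = contradiction (trans e (sym e′)) p≢p-suc
    go (inj₂ e)    (inj₂ e′)   _ = contradiction (trans e (sym e′)) p≢p-suc
    go (inj₁ refl) (inj₂ refl) j = j
    go (inj₂ refl) (inj₁ refl) j = Sum.swap j

  adjacent-triple : ∀ {a b c t} → Triple a b c (p t) → Triple a b c (p (suc t)) →
    ∃[ d ] (∀ {v} → Triple a b c v → Triple (p t) (p (suc t)) d v)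
  adjacent-triple (inj₁ e)           (inj₁ e′)          = contradiction (trans e (sym e′)) p≢p-suc
  adjacent-triple (inj₂ (inj₁ e))    (inj₂ (inj₁ e′))   = contradiction (trans e (sym e′)) p≢p-suc
  adjacent-triple (inj₂ (inj₂ e))    (inj₂ (inj₂ e′))   = contradiction (trans e (sym e′)) p≢p-suc
  adjacent-triple (inj₁ refl)        (inj₂ (inj₁ refl)) = _ , λ k → k
  adjacent-triple (inj₁ refl)        (inj₂ (inj₂ refl)) = _ , λ k → flip k
  adjacent-triple (inj₂ (inj₁ refl)) (inj₁ refl)        = _ , λ k → flip (rotate k)
  adjacent-triple (inj₂ (inj₁ refl)) (inj₂ (inj₂ refl)) = _ , λ k → rotate k
  adjacent-triple (inj₂ (inj₂ refl)) (inj₁ refl)        = _ , λ k → rotate (rotate k)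
  adjacent-triple (inj₂ (inj₂ refl)) (inj₂ (inj₁ refl)) = _ , λ k → flip (rotate (rotate k))

  -- Two adjacent rim vertices always fit between two consecutive spoke vertices, ends included, and
  -- cannot leave that segment while the hub is white.
  ∣B∣≤2⇒Stuck : ∀ {B} → ∣ B ∣ ≤ 2 → Stuck G B
  ∣B∣≤2⇒Stuck {B} ∣B∣≤2 with cover id zero B ∣B∣≤2
  ... | a Vec.∷ b Vec.∷ Vec.[] , B⊆ = from (isolated-or-adjacent a b b)
    where
    B⊆′ : ∀ {v} → v ∈ B → Triple a b b v
    B⊆′ v∈ with B⊆ v∈
    ... | here e         = inj₁ e
    ... | there (here e) = inj₂ (inj₁ e)
    from : Isolated (Triple a b b) ⊎ ∃[ t ] Triple a b b (p t) × Triple a b b (p (suc t)) → Stuck G B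
    from (inj₁ iso) = isolated-triple-stuck iso B⊆′
    from (inj₂ (t , k , k′)) =
      let j , c , eq , sc , c<j , j< = locate t
      in segment-stuck sc λ v∈ → case adjacent-pair k k′ (B⊆′ v∈) of λ
        { (inj₁ e) → j , c<j , <⇒≤ j< , trans e eq
        ; (inj₂ e) → suc j , m≤n⇒m≤1+n c<j , j< , trans e (p-cong-suc eq) }

  ZeroForcing⇒3≤ : ∀ B → ZeroForcing G B → 3 ≤ ∣ B ∣
  ZeroForcing⇒3≤ B zf = ≰⇒> λ ∣B∣≤2 → Stuck⇒¬ZeroForcing G (∣B∣≤2⇒Stuck ∣B∣≤2) zf

  start : ∀ {B} → ∣ B ∣ ≤ 3 → Stuck G B ⊎
    ∃₂ λ t d → ∀ {v} → v ∈ B → Triple (p t) (p (suc t)) d v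
  start {B} ∣B∣≤3 with cover id zero B ∣B∣≤3
  ... | a Vec.∷ b Vec.∷ c Vec.∷ Vec.[] , B⊆ = from (isolated-or-adjacent a b c)
    where
    B⊆′ : ∀ {v} → v ∈ B → Triple a b c v
    B⊆′ v∈ with B⊆ v∈
    ... | here e                 = inj₁ e
    ... | there (here e)         = inj₂ (inj₁ e)
    ... | there (there (here e)) = inj₂ (inj₂ e)
    from : Isolated (Triple a b c) ⊎ ∃[ t ] Triple a b c (p t) × Triple a b c (p (suc t)) →
           Stuck G B ⊎ ∃₂ λ t d → ∀ {v} → v ∈ B → Triple (p t) (p (suc t)) d v
    from (inj₁ iso)          = inj₁ (isolated-triple-stuck iso B⊆′)
    from (inj₂ (t , k , k′)) =
      let d , h = adjacent-triple k k′ in inj₂ (t , d , λ v∈ → h (B⊆′ v∈))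

  -- The hub is not counted in `N`, so a start that contains it is one rim vertex behind; the
  -- exceptional case relies on `N` being `2` here.
  hub-pair-within : ∀ {B t N} → 2 ≤ N → (∀ {v} → v ∈ B → Triple (p t) (p (suc t)) zero v) → Within N B
  hub-pair-within {B} {t} 2≤N B⊆ = arc t (2 + t) (+-monoˡ-≤ t 2≤N) λ v∈ → case B⊆ v∈ of λ
    { (inj₁ e)        → inj₂ (t , ≤-refl , n≤1+n (suc t) , e)
    ; (inj₂ (inj₁ e)) → inj₂ (suc t , n≤1+n t , ≤-refl , e)
    ; (inj₂ (inj₂ e)) → inj₁ e }

  pair-in-segment : ∀ {a t d v} → suc a ≤ t → t < s + suc a →
    Triple (p t) (p (suc t)) d v → Segment a t (2 + t) v ⊎ v ≡ d
  pair-in-segment {t = t} a<t t< (inj₁ e) = inj₁ (t , a<t , <⇒≤ t< , ≤-refl , n≤1+n (suc t) , e)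
  pair-in-segment {t = t} a<t t< (inj₂ (inj₁ e)) =
    inj₁ (suc t , m≤n⇒m≤1+n a<t , t< , n≤1+n t , ≤-refl , e)
  pair-in-segment a<t t< (inj₂ (inj₂ e)) = inj₂ e

  Triple-move : ∀ {t j d v} → p t ≡ p j → Triple (p t) (p (suc t)) d v → Triple (p j) (p (suc j)) d v
  Triple-move eq (inj₁ e)        = inj₁ (trans e eq)
  Triple-move eq (inj₂ (inj₁ e)) = inj₂ (inj₁ (trans e (p-cong-suc eq)))
  Triple-move eq (inj₂ (inj₂ e)) = inj₂ (inj₂ e)

  triple-within : ∀ {B} → ∣ B ∣ ≤ 3 → Within 3 B
  triple-within {B} ∣B∣≤3 with start ∣B∣≤3
  ... | inj₁ st = stuck st
  ... | inj₂ (t , d , B⊆) with d ≟ᶠ zero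
  ...   | yes refl = hub-pair-within (s≤s (s≤s z≤n)) B⊆
  ...   | no d≢0 =
    let j , a , eq , sa , a<j , j< = locate t
    in segment a j (2 + j) d d≢0 sa (<⇒≤ j<) (≤-trans (s≤s a<j) (n≤1+n (suc j))) (m≤n+m j 2) ≤-refl
       (λ v∈ → pair-in-segment a<j j< (Triple-move eq (B⊆ v∈)))

  blueAfter-bound : ∀ {B} → ∣ B ∣ ≤ 3 → ∀ k → blueAfter G B k ≡ ⊤ → n ≤ 4 + k * 2
  blueAfter-bound ∣B∣≤3 k full = ≤-trans (Within-full (Within-blueAfter (triple-within ∣B∣≤3) k) full)
    (≤-reflexive (cong suc (+-comm (k * 2) 3)))

-- The exceptional case: every other rim vertex is a spoke vertex

-- Modulo `n` the two summands add up to twice `2 + x`, so the indices are mirror images in the axis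
-- through `p (suc x)`. Here `t` is the distance of each from its end of the white window.
reflection-sum : ∀ {n lo j t k x} → x ≡ k + suc lo → j + t ≡ n + lo →
  suc j + suc (3 + (k + x) + t) ≡ n + ((2 + x) + (2 + x))
reflection-sum {n} {lo} {j} {t} {k} {x} x≡ eq = begin
  suc j + suc (3 + (k + x) + t)      ≡⟨ regroup j t (k + x) ⟩
  5 + ((j + t) + (k + x))            ≡⟨ cong (λ y → 5 + (y + (k + x))) eq ⟩
  5 + ((n + lo) + (k + x))           ≡⟨ regroup′ (n + lo) k x ⟩
  4 + (n + lo + suc k + x)           ≡⟨ cong (λ y → 4 + (y + x)) (trans (+-assoc n lo (suc k)) (cong (n +_) lo+)) ⟩
  4 + (n + x + x)                    ≡⟨ regroup″ n x ⟩
  n + ((2 + x) + (2 + x))            ∎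
  where
  open ≡-Reasoning
  lo+ : lo + suc k ≡ x
  lo+ = trans (+-suc lo k) (trans (+-comm (suc lo) k) (sym x≡))
  regroup : ∀ j t y → suc j + suc (3 + y + t) ≡ 5 + ((j + t) + y)
  regroup = solve-∀
  regroup′ : ∀ y k x → 5 + (y + (k + x)) ≡ 4 + (y + suc k + x)
  regroup′ = solve-∀
  regroup″ : ∀ n x → 4 + (n + x + x) ≡ n + ((2 + x) + (2 + x))
  regroup″ = solve-∀

module Alternating {n : ℕ} {G : Graph (suc n)} (H : HubbedCycle 2 G) (4∤n : ¬ 4 ∣ n) where
  open Graph G
  open HubbedCycle H
  open Rim H
  open LowerBound H
  open Starts H

  -- Reflection in the spoke vertex with index suc x permutes the white spoke
  -- vertices and, as 4 ∤ n, fixes none of them; so the hub never has exactly one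
  -- white neighbour.
  symmetric-arc-step : ∀ {S x} k lo → x ≡ k + suc lo → Spoke (suc x) →
    (∀ {v} → v ∈ S → v ≡ zero ⊎ Arc (suc lo) (3 + (k + x)) v) →
    ∀ {v} → v ∈ step G S → v ≡ zero ⊎ Arc lo (4 + (k + x)) v
  symmetric-arc-step {S} {x} k lo x≡ sc S⊆ v∈ with ∈-step⁻ G v∈
  ... | inj₁ v∈S = Sum.map₂ Arc-widen (S⊆ v∈S)
  ... | inj₂ (u , f) with S⊆ (proj₁ f)
  ...   | inj₂ u∈ = Arc-step u∈ f
  ...   | inj₁ refl with hub-force f
  ...     | i , si , refl , others with p-index (suc lo) (p≢0 {i})
  ...       | j , lo<j , j<n+lo , i≡j with j <? 3 + (k + x)
  ...         | yes j<hi = inj₂ (j , <⇒≤ lo<j , m≤n⇒m≤1+n j<hi , i≡j)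
  ...         | no j≮hi with m≤n⇒∃[o]m+o≡n (s≤s⁻¹ (≤-trans j<n+lo (≤-reflexive (+-suc n lo))))
  ...           | t , j+t≡ = contradiction fixed ¬fixed
    where
    hi j′ : ℕ
    hi = 3 + (k + x)
    j′ = hi + t
    hi≤j : hi ≤ j
    hi≤j = ≮⇒≥ j≮hi
    j′<n+lo : j′ < n + suc lo
    j′<n+lo = subst (j′ <_) (sym (+-suc n lo)) (s≤s (≤-trans (+-monoˡ-≤ t hi≤j) (≤-reflexive j+t≡)))
    lo<hi : suc lo ≤ hi
    lo<hi = ≤-trans (m≤n+m (suc lo) k) (≤-trans (≤-reflexive (sym x≡)) (≤-trans (m≤n+m x k) (m≤n+m (k + x) 3)))
    sj : Spoke j
    sj = Spoke-cong i≡j si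
    sum : suc j + suc j′ ≡ n + ((2 + x) + (2 + x))
    sum = reflection-sum {n} {lo} {j} {t} {k} x≡ j+t≡
    sj′ : Spoke j′
    sj′ = ∣m+n∣m⇒∣n (subst (2 ∣_) (sym sum) (∣m∣n⇒∣m+n s∣n (∣m∣n⇒∣m+n sc sc))) sj
    fixed : p j ≡ p j′
    fixed = decidable-stable (p j ≟ᶠ p j′) λ j≢j′ →
      case S⊆ (others sj′ (λ e → j≢j′ (sym (trans e i≡j)))) of λ
      { (inj₁ e) → p≢0 e ; (inj₂ in-arc) → Arc-misses (m≤m+n hi t) j′<n+lo in-arc }
    double : ∀ {x} → 2 ∣ x → 4 ∣ x + x
    double (divides q refl) = divides q (twice q)
      where
      twice : ∀ q → q * 2 + q * 2 ≡ q * 4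
      twice = solve-∀
    ¬fixed : p j ≢ p j′
    ¬fixed e with <-cmp j j′
    ... | tri< j<j′ _ _ = p-distinct j<j′ (≤-trans j′<n+lo (+-monoʳ-≤ n lo<j)) e
    ... | tri> _ _ j′<j = p-distinct j′<j
            (≤-trans j<n+lo (+-monoʳ-≤ n (≤-trans lo<hi (m≤m+n hi t)))) (sym e)
    -- A white spoke vertex on the axis would make twice `suc j` equal to `n` plus twice `2 + x`; as
    -- `suc j` and `2 + x` are even, `4` would divide `n`.
    ... | tri≈ _ j≡j′ _ = 4∤n (∣m+n∣m⇒∣n
            (subst (4 ∣_) (trans (trans (cong (λ y → suc j + suc y) j≡j′) sum) (+-comm n _)) (double sj))
            (double sc))

  symmetric-arc : ∀ {B x} k lo → x ≡ k + lo → Spoke (suc x) →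
    (∀ {v} → v ∈ B → Triple (p x) (p (suc x)) (p (2 + x)) v) →
    ∀ {v} → v ∈ blueAfter G B k → v ≡ zero ⊎ Arc lo (3 + (k + x)) v
  symmetric-arc zero lo refl _ B⊆ v∈ = inj₂ (case B⊆ v∈ of λ
    { (inj₁ e)        → lo , ≤-refl , m≤n+m (suc lo) 2 , e
    ; (inj₂ (inj₁ e)) → suc lo , n≤1+n lo , n≤1+n (2 + lo) , e
    ; (inj₂ (inj₂ e)) → 2 + lo , m≤n+m lo 2 , ≤-refl , e })
  symmetric-arc (suc k) lo x≡ sc B⊆ =
    symmetric-arc-step k lo x≡′ sc (symmetric-arc k (suc lo) x≡′ sc B⊆)
    where x≡′ = trans x≡ (sym (+-suc k lo))

  p-shift* : ∀ k i → p (k * n + i) ≡ p i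
  p-shift* zero    i = refl
  p-shift* (suc k) i = trans (cong p (+-assoc n (k * n) i)) (trans (p-shift (k * n + i)) (p-shift* k i))

  Bounded : Subset (suc n) → Set
  Bounded B = ∀ k → blueAfter G B k ≡ ⊤ → n ≤ 3 + k * 2

  bounded-within : ∀ {B} → Within 2 B → Bounded B
  bounded-within w k full = ≤-trans (Within-full (Within-blueAfter w k) full)
    (≤-reflexive (cong suc (+-comm (k * 2) 2)))

  symmetric-bounded : ∀ {B x} → Spoke (suc x) →
    (∀ {v} → v ∈ B → Triple (p x) (p (suc x)) (p (2 + x)) v) → Bounded B
  symmetric-bounded {B} {x} sc B⊆ k full with m≤n⇒∃[o]m+o≡n k≤x′
    where
    instance
      n≢0 : NonZero n
      n≢0 = >-nonZero (≤-trans (s≤s z≤n) 6≤n)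
    -- After `k` full turns there is room for `k` steps below the axis.
    k≤x′ : k ≤ k * n + x
    k≤x′ = ≤-trans (m≤m*n k n) (m≤m+n (k * n) x)
  ... | lo , k+lo≡ = +-cancelʳ-≤ lo n (3 + k * 2) (begin
    n + lo                       ≤⟨ arc-full′ (λ {v} → symmetric-arc k lo (sym k+lo≡)
                                      (Spoke-cong (p-cong-suc (sym eq)) sc) B⊆′
                                      (subst (v ∈_) (sym full) ∈⊤)) ⟩
    3 + (k + (k * n + x))        ≡⟨ cong (λ y → 3 + (k + y)) (sym k+lo≡) ⟩
    3 + (k + (k + lo))           ≡⟨ regroup k lo ⟩
    3 + k * 2 + lo               ∎)
    where
    open ≤-Reasoning
    eq : p (k * n + x) ≡ p x
    eq = p-shift* k x
    B⊆′ : ∀ {v} → v ∈ B → Triple (p (k * n + x)) (p (suc (k * n + x))) (p (2 + (k * n + x))) v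
    B⊆′ v∈ with B⊆ v∈
    ... | inj₁ e        = inj₁ (trans e (sym eq))
    ... | inj₂ (inj₁ e) = inj₂ (inj₁ (trans e (sym (p-cong-suc eq))))
    ... | inj₂ (inj₂ e) = inj₂ (inj₂ (trans e (sym (p-cong-suc (p-cong-suc eq)))))
    regroup : ∀ k lo → 3 + (k + (k + lo)) ≡ 3 + k * 2 + lo
    regroup = solve-∀

  -- Three consecutive rim vertices either have spoke vertices at both ends, and are stuck, or are
  -- centred at one.
  consecutive-bounded : ∀ {B x} → (∀ {v} → v ∈ B → Triple (p x) (p (suc x)) (p (2 + x)) v) → Bounded B
  consecutive-bounded {B} {x} B⊆ with locate x
  ... | j , a , eq , sa , a<j , j< with m≤n⇒m<n∨m≡n a<j
  ...   | inj₂ refl = bounded-within (stuck (segment-stuck sa λ v∈ → case B⊆ v∈ of λ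
      { (inj₁ e) → suc a , ≤-refl , m≤n+m (suc a) 2 , trans e eq
      ; (inj₂ (inj₁ e)) → 2 + a , n≤1+n (suc a) , n≤1+n (2 + a) , trans e (p-cong-suc eq)
      ; (inj₂ (inj₂ e)) → 3 + a , m≤n+m (suc a) 2 , ≤-refl , trans e (p-cong-suc (p-cong-suc eq)) }))
  ...   | inj₁ a<j′ with ≤-antisym (s≤s⁻¹ j<) a<j′
  ...     | refl = symmetric-bounded {x = 2 + a} (spoke-after sa) λ v∈ → case B⊆ v∈ of λ
      { (inj₁ e) → inj₁ (trans e eq)
      ; (inj₂ (inj₁ e)) → inj₂ (inj₁ (trans e (p-cong-suc eq)))
      ; (inj₂ (inj₂ e)) → inj₂ (inj₂ (trans e (p-cong-suc (p-cong-suc eq)))) }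

  -- The pair lies in a segment of only three vertices, so the first step adds at most one vertex:
  -- the estimate after it is `4` where two per step would give `5`.
  separated-bounded : ∀ {B t d} → d ≢ zero → d ≢ p (2 + t) →
    (∀ {i} → d ≡ p i → p (suc i) ≢ p t) →
    (∀ {v} → v ∈ B → Triple (p t) (p (suc t)) d v) → Bounded B
  separated-bounded {B} {t} {d} d≢0 ≢above ≢below B⊆ with locate t
  ... | j@(suc i) , a , eq , sa , a<j , j< = λ
    { zero full → contradiction (Within-full {3} within₀ full) (<⇒≱ (≤-trans (n≤1+n 5) 6≤n))
    ; (suc k) full → ≤-trans (Within-full (later k) full) (≤-reflexive (cong suc (+-comm (k * 2) 4))) }
    where
    B⊆′ : ∀ {v} → v ∈ B → Segment a j (2 + j) v ⊎ v ≡ d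
    B⊆′ v∈ = pair-in-segment a<j j< (Triple-move eq (B⊆ v∈))
    within₀ : Within 3 B
    within₀ = segment a j (2 + j) d d≢0 sa (<⇒≤ j<) (≤-trans (s≤s a<j) (n≤1+n (suc j))) (m≤n+m j 2) ≤-refl B⊆′
    ≢above′ : d ≢ p (2 + j)
    ≢above′ e = ≢above (trans e (sym (p-cong-suc (p-cong-suc eq))))
    ≢below′ : d ≢ p i
    ≢below′ e = ≢below e (sym eq)
    whole : ∀ {lo hi v} → Segment a lo hi v → Segment a (suc a) (4 + a) v
    whole (i , a<i , i≤ , _ , _ , e) = i , a<i , i≤ , a<i , s≤s i≤ , e
    within₁ : Within 4 (step G B)
    within₁ = segment a (suc a) (4 + a) d d≢0 sa (m≤n+m (suc a) 2) (m≤n+m (2 + a) 2) (m≤n+m (suc a) 3) ≤-refl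
      λ v∈ → case ∈-step⁻ G v∈ of λ
      { (inj₁ v∈B) → Sum.map₁ whole (B⊆′ v∈B)
      ; (inj₂ (u , f)) → inj₁ (whole (segment-force sa B⊆′ d≢0
          (λ j≤a e → ≢below′ (subst (λ x → d ≡ p x) (suc-injective (≤-antisym a<j j≤a)) e))
          (λ { refl <2+j e → ≢above′ (subst (λ x → d ≡ p (suc x)) (≤-antisym (s≤s⁻¹ <2+j) j<) e) })
          ≢above′ ≢below′ f)) }
    later : ∀ k → Within (k * 2 + 4) (blueAfter G B (suc k))
    later zero    = within₁
    later (suc k) = Within-step (later k)

  alternating-bound : ∀ {B} → ∣ B ∣ ≤ 3 → Bounded B
  alternating-bound ∣B∣≤3 with start ∣B∣≤3
  ... | inj₁ st = bounded-within (stuck st)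
  ... | inj₂ (t , d , B⊆) with d ≟ᶠ zero | d ≟ᶠ p (2 + t)
  ...   | yes refl | _        = bounded-within (hub-pair-within ≤-refl B⊆)
  ...   | no _     | yes refl = consecutive-bounded B⊆
  ...   | no d≢0   | no ≢above with p-index 0 d≢0
  ...     | i , _ , _ , refl with p (suc i) ≟ᶠ p t
  ...       | yes e = consecutive-bounded {x = i} λ v∈ → case B⊆ v∈ of λ
      { (inj₁ e′) → inj₂ (inj₁ (trans e′ (sym e)))
      ; (inj₂ (inj₁ e′)) → inj₂ (inj₂ (trans e′ (sym (p-cong-suc e))))
      ; (inj₂ (inj₂ e′)) → inj₁ e′ }
  ...       | no ≢t = separated-bounded d≢0 ≢above (λ e → ≢t ∘ trans (p-cong-suc e)) B⊆

-- Initial sets that attain the bounds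

-- Abstract so that a, b and c can be inferred from triple a b c.
abstract
  triple : ∀ {n} (a b c : Fin n) → Subset n
  triple a b c = ⁅ a ⁆ ∪ (⁅ b ⁆ ∪ ⁅ c ⁆)

  ∣triple∣≤3 : ∀ {n} (a b c : Fin n) → ∣ triple a b c ∣ ≤ 3
  ∣triple∣≤3 a b c = ≤-trans (∣p∪q∣≤∣p∣+∣q∣ ⁅ a ⁆ (⁅ b ⁆ ∪ ⁅ c ⁆))
    (+-mono-≤ (≤-reflexive (∣⁅x⁆∣≡1 a)) (≤-trans (∣p∪q∣≤∣p∣+∣q∣ ⁅ b ⁆ ⁅ c ⁆)
      (+-mono-≤ (≤-reflexive (∣⁅x⁆∣≡1 b)) (≤-reflexive (∣⁅x⁆∣≡1 c)))))

  ∈-triple₁ : ∀ {n} {a b c : Fin n} → a ∈ triple a b c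
  ∈-triple₁ {a = a} = x∈p∪q⁺ (inj₁ (x∈⁅x⁆ a))

  ∈-triple₂ : ∀ {n} {a b c : Fin n} → b ∈ triple a b c
  ∈-triple₂ {b = b} = x∈p∪q⁺ (inj₂ (x∈p∪q⁺ (inj₁ (x∈⁅x⁆ b))))

  ∈-triple₃ : ∀ {n} {a b c : Fin n} → c ∈ triple a b c
  ∈-triple₃ {c = c} = x∈p∪q⁺ (inj₂ (x∈p∪q⁺ (inj₂ (x∈⁅x⁆ c))))

module UpperBound {n s : ℕ} {G : Graph (suc n)} (H : HubbedCycle s G) where
  open Graph G
  open HubbedCycle H
  open Rim H

  clockwise : ∀ {S i} → p i ∈ S → p (suc i) ∈ S → (Spoke (suc i) → zero ∈ S) → p (2 + i) ∈ step G S
  clockwise {S} {i} i∈ si∈ hub = step-force G si∈ (adj-suc (suc i)) λ w uw w≢ → case neighbour i uw of λ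
    { (inj₁ refl)               → i∈
    ; (inj₂ (inj₁ e))           → contradiction e w≢
    ; (inj₂ (inj₂ (refl , si))) → hub si }

  anticlockwise : ∀ {S i} → p (suc i) ∈ S → p (2 + i) ∈ S → (Spoke (suc i) → zero ∈ S) → p i ∈ step G S
  anticlockwise {S} {i} si∈ 2+i∈ hub = step-force G si∈ (symm (adj-suc i)) λ w uw w≢ → case neighbour i uw of λ
    { (inj₁ e)                  → contradiction e w≢
    ; (inj₂ (inj₁ refl))        → 2+i∈
    ; (inj₂ (inj₂ (refl , si))) → hub si }

  inwards : ∀ {S i} → Spoke (suc i) → p i ∈ S → p (suc i) ∈ S → p (2 + i) ∈ S → zero ∈ step G S
  inwards {S} {i} si i∈ si∈ 2+i∈ = step-force G si∈ (symm (adj-hub si)) λ w uw w≢ → case neighbour i uw of λ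
    { (inj₁ refl)            → i∈
    ; (inj₂ (inj₁ refl))     → 2+i∈
    ; (inj₂ (inj₂ (e , _)))  → contradiction e w≢ }

  outwards : ∀ {S} c → zero ∈ S → Spoke c →
    (∀ j → c ≤ j → j < n + c → Spoke j → j ≢ c → p j ∈ S) → p c ∈ step G S
  outwards c 0∈ sc others = step-force G 0∈ (adj-hub sc) λ w uw w≢ →
    case p-index c {w} (λ { refl → irrefl refl uw }) of λ
    { (j , c≤j , j< , refl) → others j c≤j j< (hub-spoke uw) (λ { refl → w≢ refl }) }

  Blue : Subset (suc n) → ℕ → ℕ → Set
  Blue S lo hi = ∀ i → lo ≤ i → i < hi → p i ∈ S

  Blue-extendˡ : ∀ {S lo hi} → p lo ∈ S → Blue S (suc lo) hi → Blue S lo hi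
  Blue-extendˡ lo∈ blue i lo≤i i<hi with m≤n⇒m<n∨m≡n lo≤i
  ... | inj₁ lo<i = blue i lo<i i<hi
  ... | inj₂ refl = lo∈

  Blue-extendʳ : ∀ {S lo hi} → p hi ∈ S → Blue S lo hi → Blue S lo (suc hi)
  Blue-extendʳ hi∈ blue i lo≤i i≤hi with m≤n⇒m<n∨m≡n (s≤s⁻¹ i≤hi)
  ... | inj₁ i<hi = blue i lo≤i i<hi
  ... | inj₂ refl = hi∈

  grow : ∀ {S} lo hi → zero ∈ S → 3 + lo ≤ hi → Blue S (suc lo) hi → Blue (step G S) lo (suc hi)
  grow lo (suc (suc hi)) 0∈ (s≤s (s≤s lo<hi)) blue =
    Blue-extendˡ (anticlockwise (blue (suc lo) ≤-refl (s≤s (m≤n⇒m≤1+n lo<hi)))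
                                (blue (2 + lo) (n≤1+n (suc lo)) (s≤s (s≤s lo<hi))) (λ _ → 0∈))
      (Blue-extendʳ (clockwise (blue hi lo<hi (n≤1+n (suc hi)))
                               (blue (suc hi) (m≤n⇒m≤1+n lo<hi) ≤-refl) (λ _ → 0∈))
        (λ i lo≤i i<hi → ⊆-step G (blue i lo≤i i<hi)))

  grow* : ∀ {B k} t lo hi → zero ∈ blueAfter G B k → 2 + (t + lo) ≤ hi →
    Blue (blueAfter G B k) (t + lo) hi → Blue (blueAfter G B (t + k)) lo (t + hi)
  grow* zero lo hi 0∈ _ blue = blue
  grow* {B} {k} (suc t) lo hi 0∈ long blue =
    grow lo (t + hi) (blueAfter-mono G (m≤n+m k t) 0∈)
      (≤-trans (s≤s (s≤s (s≤s (m≤n+m lo t)))) (≤-trans long (m≤n+m hi t)))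
      (grow* t (suc lo) hi 0∈
        (subst (λ x → 2 + x ≤ hi) (sym (+-suc t lo)) long)
        (subst (λ x → Blue (blueAfter G B k) x hi) (sym (+-suc t lo)) blue))

  full : ∀ {S lo hi} → zero ∈ S → n + lo ≤ hi → Blue S lo hi → S ≡ ⊤
  full {S} {lo} 0∈ n≤ blue = ⊆-antisym ⊆⊤ λ {v} _ → all v
    where
    all : ∀ v → v ∈ S
    all v with v ≟ᶠ zero
    ... | yes refl = 0∈
    ... | no v≢0 with p-index lo v≢0
    ...   | i , lo≤i , i<n+lo , refl = blue i lo≤i (<-≤-trans i<n+lo n≤)

  FillsIn : ℕ → Set
  FillsIn k = ∃[ B ] ∣ B ∣ ≤ 3 × blueAfter G B k ≡ ⊤

  hub-start : ∀ t → n ≡ t + (2 + t) → FillsIn t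
  hub-start t n≡ = B , ∣triple∣≤3 _ _ _ , subst (λ k → blueAfter G B k ≡ ⊤) (+-identityʳ t)
    (full (blueAfter-mono G {B} {0} {t + 0} z≤n ∈-triple₁) (≤-reflexive (trans (+-identityʳ n) n≡))
      (grow* t 0 (2 + t) ∈-triple₁ (≤-reflexive (cong (2 +_) (+-identityʳ t)))
        (subst (λ x → Blue B x (2 + t)) (sym (+-identityʳ t))
          (Blue-extendˡ ∈-triple₂ (Blue-extendˡ ∈-triple₃ λ i <i i< → contradiction i< (≤⇒≯ <i))))))
    where B = triple zero (p t) (p (suc t))

  module Centred (x : ℕ) (sx : Spoke (2 + x)) where
    B : Subset (suc n)
    B = triple (p (1 + x)) (p (2 + x)) (p (3 + x))

    0∈ : zero ∈ blueAfter G B 1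
    0∈ = inwards sx ∈-triple₁ ∈-triple₂ ∈-triple₃

    blue₁ : Blue (blueAfter G B 1) x (5 + x)
    blue₁ = Blue-extendˡ (anticlockwise ∈-triple₁ ∈-triple₂ (λ s → contradiction sx (¬consecutive-spokes s)))
      (Blue-extendˡ (⊆-step G ∈-triple₁) (Blue-extendˡ (⊆-step G ∈-triple₂) (Blue-extendˡ (⊆-step G ∈-triple₃)
      (Blue-extendˡ (clockwise ∈-triple₂ ∈-triple₃ (λ s → contradiction s (¬consecutive-spokes sx)))
      λ i <i i< → contradiction i< (≤⇒≯ <i)))))

  centred-start : ∀ t → n ≡ t + (5 + t) → FillsIn (t + 1)
  centred-start t n≡ = B , ∣triple∣≤3 _ _ _ , full (blueAfter-mono G {k = t + 1} (m≤n+m 1 t) 0∈)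
      (≤-reflexive length)
      (grow* t (2 + t) (5 + (t + (2 + t))) 0∈ (m≤n+m (2 + (t + (2 + t))) 3) blue₁)
    where
    -- The centre is chosen as the vertex with index `n - 1`, which is always a spoke vertex.
    sx : Spoke (2 + (t + (2 + t)))
    sx = subst (s ∣_) (trans n≡ (index t)) s∣n
      where
      index : ∀ t → t + (5 + t) ≡ 3 + (t + (2 + t))
      index = solve-∀
    open Centred (t + (2 + t)) sx
    length : n + (2 + t) ≡ t + (5 + (t + (2 + t)))
    length = trans (cong (_+ (2 + t)) n≡) (sums t)
      where
      sums : ∀ t → t + (5 + t) + (2 + t) ≡ t + (5 + (t + (2 + t)))
      sums = solve-∀

  spoke-distance : ∀ {c j} → Spoke c → Spoke j → c ≤ j → j ≢ c → s + c ≤ j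
  spoke-distance {c} {j} sc sj c≤j j≢c = s≤s⁻¹ (subst (_≤ suc j) (+-suc s c)
    (multiples-apart sc sj (s≤s (≤∧≢⇒< c≤j (j≢c ∘ sym)))))

  spoke-distance′ : ∀ {c j} → Spoke c → Spoke j → j < n + c → s + j ≤ n + c
  spoke-distance′ {c} {j} sc sj j< = spoke-distance sj
    (subst (s ∣_) (+-suc n c) (∣m∣n⇒∣m+n s∣n sc)) (<⇒≤ j<) (<⇒≢ j< ∘ sym)

  -- When the spoke vertex opposite to the initial one is the last white one, the
  -- hub forces it.
  antipodal-start : ∀ t₁ s′ t → s ≡ suc s′ → t ≡ t₁ + s′ → s ∣ 3 + t → n ≡ t + (6 + t) → FillsIn (t + 1)
  antipodal-start t₁ s′ t s≡ t≡ s∣ n≡ = B , ∣triple∣≤3 _ _ _ , full {lo = c}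
      (blueAfter-mono G {k = t + 1} (m≤n+m 1 t) 0∈)
      (≤-reflexive n+c≡)
      (Blue-extendˡ (blueAfter-mono G time last)
        (grow* t (3 + t) (5 + x) 0∈ (m≤n+m (2 + x) 3) blue₁))
    where
    c x : ℕ
    c = 2 + t
    x = t + (3 + t)
    sx : Spoke (2 + x)
    sx = subst (s ∣_) (index t) (∣m∣n⇒∣m+n s∣ s∣)
      where
      index : ∀ t → (3 + t) + (3 + t) ≡ 3 + (t + (3 + t))
      index = solve-∀
    open Centred x sx
    n+c≡ : n + c ≡ t + (5 + x)
    n+c≡ = trans (cong (_+ c) n≡) (sums t)
      where
      sums : ∀ t → t + (6 + t) + (2 + t) ≡ t + (5 + (t + (3 + t)))
      sums = solve-∀
    0<s′ : 1 ≤ s′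
    0<s′ = s≤s⁻¹ (subst (2 ≤_) s≡ 2≤s)
    time : suc (t₁ + 1) ≤ t + 1
    time = +-monoˡ-≤ 1 (subst (suc t₁ ≤_) (sym t≡) (subst (_≤ t₁ + s′) (+-comm t₁ 1) (+-monoʳ-≤ t₁ 0<s′)))
    x≡ : x ≡ t₁ + (s′ + (3 + t))
    x≡ = trans (cong (_+ (3 + t)) t≡) (+-assoc t₁ s′ (3 + t))
    -- After these `t₁` further steps the arc ends exactly at the spoke vertices `s + c` and
    -- `n + c - s`, the nearest ones on either side of `c`.
    blue : Blue (blueAfter G B (t₁ + 1)) (s′ + (3 + t)) (t₁ + (5 + x))
    blue = grow* t₁ (s′ + (3 + t)) (5 + x) 0∈
      (≤-trans (s≤s (s≤s (≤-reflexive (sym x≡)))) (m≤n+m (2 + x) 3))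
      (subst (λ y → Blue (blueAfter G B 1) y (5 + x)) x≡ blue₁)
    last : p c ∈ blueAfter G B (suc (t₁ + 1))
    last = outwards c (blueAfter-mono G {k = t₁ + 1} (m≤n+m 1 t₁) 0∈) s∣ λ j c≤j j< sj j≢c → blue j
      (subst (_≤ j) (trans (cong (_+ c) s≡) (sym (+-suc s′ c))) (spoke-distance s∣ sj c≤j j≢c))
      (+-cancelˡ-≤ s′ (suc j) (t₁ + (5 + x)) (begin
        s′ + suc j              ≡⟨ +-suc s′ j ⟩
        suc s′ + j              ≡⟨ cong (_+ j) (sym s≡) ⟩
        s + j                   ≤⟨ spoke-distance′ s∣ sj j< ⟩
        n + c                   ≡⟨ n+c≡ ⟩
        t + (5 + x)             ≡⟨ cong (_+ (5 + x)) (trans t≡ (+-comm t₁ s′)) ⟩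
        s′ + t₁ + (5 + x)       ≡⟨ +-assoc s′ t₁ (5 + x) ⟩
        s′ + (t₁ + (5 + x))     ∎))
      where open ≤-Reasoning

  -- The blue arc is shifted by one from being symmetric about the spoke vertex
  -- with index 2 + x, so that the spoke vertices are not all reached in pairs.
  offset-start : ∀ t g → 4 ≤ s → s ≡ suc g + suc g → s ∣ 4 + t →
    n ≡ (4 + t) + (4 + t) + s → FillsIn (g + suc (t + 2))
  offset-start t g 4≤s s≡ s∣ n≡ = B , ∣triple∣≤3 _ _ _ , full {lo = suc g}
      (blueAfter-mono G {k = g + suc (t + 2)} time 0∈)
      (≤-reflexive (trans (cong (_+ suc g) (trans n≡ (cong (4 + t + (4 + t) +_) s≡))) (sums t g)))
      (grow* g (suc g) (suc (t + (7 + x))) (blueAfter-mono G {k = suc (t + 2)} (m≤n⇒m≤1+n (m≤n+m 2 t)) 0∈) long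
        -- After `t + 2` steps the upper end has just reached the spoke vertex `n + c - s`, and the
        -- lower end is at `2 + c`. In the next step the arc takes `1 + c` while the hub forces `c`,
        -- so the lower end gains two.
        (Blue-extendˡ last (grow (suc c) (t + (7 + x)) (blueAfter-mono G {k = t + 2} (m≤n+m 2 t) 0∈) long′ blue)))
    where
    c x : ℕ
    c = g + suc g
    x = t + (2 + c)
    B : Subset (suc n)
    -- The gap is at the spoke vertex `2 + x`, which turns blue in the first step and forces the hub
    -- in the second. The arc is then centred at `3 + x`.
    B = triple (p (1 + x)) (p (3 + x)) (p (4 + x))
    time : 2 ≤ g + suc (t + 2)
    time = ≤-trans (m≤n⇒m≤1+n (m≤n+m 2 t)) (m≤n+m (suc (t + 2)) g)
    sums : ∀ t g → (4 + t) + (4 + t) + (suc g + suc g) + suc g ≡ g + suc (t + (7 + (t + (2 + (g + suc g)))))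
    sums = solve-∀
    long′ : 3 + suc c ≤ t + (7 + x)
    long′ = ≤-trans (s≤s (s≤s (≤-trans (m≤n+m (2 + c) t) (m≤n+m x 5)))) (m≤n+m (7 + x) t)
    long : 2 + (g + suc g) ≤ suc (t + (7 + x))
    long = ≤-trans (m≤n+m (2 + c) 2) (m≤n⇒m≤1+n long′)
    sc : Spoke c
    sc = ∣-reflexive s≡
    sx : Spoke (2 + x)
    sx = subst (s ∣_) (index t c) (∣m∣n⇒∣m+n s∣ sc)
      where
      index : ∀ t c → (4 + t) + suc c ≡ 3 + (t + (2 + c))
      index = solve-∀
    ¬spoke : ∀ d → suc d < 4 → ¬ Spoke (suc d + (2 + x))
    ¬spoke d d<3 sy = <⇒≱ (≤-trans d<3 4≤s) (+-cancelʳ-≤ (2 + x) s (suc d)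
      (spoke-distance sx sy (m≤n+m (2 + x) (suc d)) (λ e → m≢1+n+m (2 + x) (sym e))))
    S₁ : Subset (suc n)
    S₁ = blueAfter G B 1
    2+x∈ : p (2 + x) ∈ S₁
    2+x∈ = anticlockwise ∈-triple₂ ∈-triple₃ λ sy → contradiction sy (¬spoke 0 (s≤s (s≤s z≤n)))
    5+x∈ : p (5 + x) ∈ S₁
    5+x∈ = clockwise ∈-triple₂ ∈-triple₃ λ sy → contradiction sy (¬spoke 1 (s≤s (s≤s (s≤s z≤n))))
    1+x∈ : p (1 + x) ∈ S₁
    1+x∈ = ⊆-step G ∈-triple₁
    3+x∈ : p (3 + x) ∈ S₁
    3+x∈ = ⊆-step G ∈-triple₂
    4+x∈ : p (4 + x) ∈ S₁
    4+x∈ = ⊆-step G ∈-triple₃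
    0∈ : zero ∈ blueAfter G B 2
    0∈ = inwards sx 1+x∈ 2+x∈ 3+x∈
    blue₂ : Blue (blueAfter G B 2) x (7 + x)
    blue₂ = Blue-extendˡ (anticlockwise 1+x∈ 2+x∈ λ sy → contradiction sx (¬consecutive-spokes sy))
      (Blue-extendˡ (⊆-step G 1+x∈) (Blue-extendˡ (⊆-step G 2+x∈) (Blue-extendˡ (⊆-step G 3+x∈)
      (Blue-extendˡ (⊆-step G 4+x∈) (Blue-extendˡ (⊆-step G 5+x∈)
      (Blue-extendˡ (clockwise 4+x∈ 5+x∈ λ sy → contradiction sy (¬spoke 2 ≤-refl))
      λ i <i i< → contradiction i< (≤⇒≯ <i)))))))
    blue : Blue (blueAfter G B (t + 2)) (2 + c) (t + (7 + x))
    blue = grow* t (2 + c) (7 + x) 0∈ (m≤n+m (2 + x) 5) blue₂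
    last : p c ∈ blueAfter G B (suc (t + 2))
    last = outwards c (blueAfter-mono G {k = t + 2} (m≤n+m 2 t) 0∈) sc λ j c≤j j< sj j≢c → blue j
      (≤-trans (+-monoˡ-≤ c 2≤s) (spoke-distance sc sj c≤j j≢c))
      (+-cancelˡ-≤ s (suc j) (t + (7 + x)) (begin
        s + suc j                          ≡⟨ +-suc s j ⟩
        suc (s + j)                        ≤⟨ s≤s (spoke-distance′ sc sj j<) ⟩
        suc (n + c)                        ≡⟨ cong (λ y → suc (y + c)) n≡ ⟩
        suc ((4 + t) + (4 + t) + s + c)    ≡⟨ ends t s c ⟩
        s + (t + (7 + x))                  ∎))
      where
      open ≤-Reasoning
      ends : ∀ t s c → suc ((4 + t) + (4 + t) + s + c) ≡ s + (t + (7 + (t + (2 + c))))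
      ends = solve-∀

-- Arithmetic modulo n, and the gear graph as a cycle with a hub

module Modular (n : ℕ) .{{_ : NonZero n}} where
  %-cong-suc : ∀ {i j} → i % n ≡ j % n → suc i % n ≡ suc j % n
  %-cong-suc {i} {j} eq = begin
    suc i % n             ≡⟨ %-distribˡ-+ 1 i n ⟩
    (1 % n + i % n) % n   ≡⟨ cong (λ x → (1 % n + x) % n) eq ⟩
    (1 % n + j % n) % n   ≡⟨ %-distribˡ-+ 1 j n ⟨
    suc j % n             ∎
    where open ≡-Reasoning

  [n+m]%n≡m%n : ∀ i → (n + i) % n ≡ i % n
  [n+m]%n≡m%n i = trans (cong (_% n) (+-comm n i)) ([m+n]%n≡m%n i n)

  suc[m%n]%n≡suc[m]%n : ∀ i → suc (i % n) % n ≡ suc i % n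
  suc[m%n]%n≡suc[m]%n i = %-cong-suc {i % n} {i} (m%n%n≡m%n i n)

  %-cancel-suc : ∀ {i j} → suc i % n ≡ suc j % n → i % n ≡ j % n
  %-cancel-suc {i} {j} eq = trans (around i) (trans (cong (λ x → (pred n % n + x) % n) eq) (sym (around j)))
    where
    around : ∀ i → i % n ≡ (pred n % n + suc i % n) % n
    around i = begin
      i % n                          ≡⟨ [n+m]%n≡m%n i ⟨
      (n + i) % n                    ≡⟨ cong (λ x → (x + i) % n) (suc-pred n) ⟨
      (suc (pred n) + i) % n         ≡⟨ cong (_% n) (+-suc (pred n) i) ⟨
      (pred n + suc i) % n           ≡⟨ %-distribˡ-+ (pred n) (suc i) n ⟩
      (pred n % n + suc i % n) % n   ∎
      where open ≡-Reasoning

  %-cancelˡ-+ : ∀ k {i j} → (k + i) % n ≡ (k + j) % n → i % n ≡ j % n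
  %-cancelˡ-+ zero    eq = eq
  %-cancelˡ-+ (suc k) {i} {j} eq = %-cancelˡ-+ k (%-cancel-suc {k + i} {k + j} eq)

  %-distinct : ∀ {i j} → i < j → j < n + i → i % n ≢ j % n
  %-distinct {i} {j} i<j j<n+i eq with m≤n⇒∃[o]m+o≡n i<j
  ... | o , refl = case trans (sym (0%n)) (trans 0≡ (m<n⇒m%n≡m so<n)) of λ ()
    where
    so<n : suc o < n
    so<n = +-cancelˡ-< i (suc o) n (subst₂ _<_ (sym (+-suc i o)) (+-comm n i) j<n+i)
    0%n : 0 % n ≡ 0
    0%n = m<n⇒m%n≡m (≤-trans (s≤s z≤n) so<n)
    0≡ : 0 % n ≡ suc o % n
    0≡ = %-cancelˡ-+ i {0} {suc o} (trans (cong (_% n) (+-identityʳ i)) (trans eq (cong (_% n) (sym (+-suc i o)))))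

∣m-n∣≡1⇒ : ∀ a b → ∣ a - b ∣ ≡ 1 → a ≡ suc b ⊎ b ≡ suc a
∣m-n∣≡1⇒ zero    b       eq = inj₂ eq
∣m-n∣≡1⇒ (suc a) zero    eq = inj₁ eq
∣m-n∣≡1⇒ (suc a) (suc b) eq = Sum.map (cong suc) (cong suc) (∣m-n∣≡1⇒ a b eq)

∣n-suc[n]∣≡1 : ∀ a → ∣ a - suc a ∣ ≡ 1
∣n-suc[n]∣≡1 zero    = refl
∣n-suc[n]∣≡1 (suc a) = ∣n-suc[n]∣≡1 a

module Gear (m r : ℕ) (3≤m : 3 ≤ m) (1≤r : 1 ≤ r) where
  open Graph (Gr m r)

  private
    s n : ℕ
    s = r + 1
    n = m * s

    instance
      m≢0 : NonZero m
      m≢0 = >-nonZero (≤-trans (s≤s z≤n) 3≤m)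
      s≢0 : NonZero s
      s≢0 = >-nonZero (≤-trans 1≤r (m≤m+n r 1))
      n≢0 : NonZero n
      n≢0 = m*n≢0 m s

  open Modular n

  2≤s : 2 ≤ s
  2≤s = +-monoˡ-≤ 1 1≤r

  s∣n : s ∣ n
  s∣n = n∣m*n m

  3s≤n : s + s + s ≤ n
  3s≤n = ≤-trans (≤-reflexive (triple-sum s)) (*-monoˡ-≤ s 3≤m)
    where
    triple-sum : ∀ s → s + s + s ≡ 3 * s
    triple-sum = solve-∀

  p : ℕ → Fin (suc n)
  p i = suc (fromℕ< (m%n<n i n))

  toℕ-p : ∀ i → toℕ (p i) ≡ suc (i % n)
  toℕ-p i = cong suc (toℕ-fromℕ< (m%n<n i n))

  p-cong : ∀ {i j} → i % n ≡ j % n → p i ≡ p j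
  p-cong {i} {j} eq = toℕ-injective (trans (toℕ-p i) (trans (cong suc eq) (sym (toℕ-p j))))

  p-injective : ∀ {i j} → p i ≡ p j → i % n ≡ j % n
  p-injective {i} {j} eq = suc-injective (trans (sym (toℕ-p i)) (trans (cong toℕ eq) (toℕ-p j)))

  p-toℕ : ∀ f → suc f ≡ p (toℕ f)
  p-toℕ f = toℕ-injective (trans (cong suc (sym (m<n⇒m%n≡m (toℕ<n f)))) (sym (toℕ-p (toℕ f))))

  p-index : ∀ lo {v} → v ≢ zero → ∃[ i ] lo ≤ i × i < n + lo × v ≡ p i
  p-index _ {zero} v≢0 = contradiction refl v≢0
  p-index zero {suc f} _ = toℕ f , z≤n , subst (toℕ f <_) (sym (+-identityʳ n)) (toℕ<n f) , p-toℕ f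
  p-index (suc lo) v≢0 with p-index lo v≢0
  ... | i , lo≤i , i< , eq with m≤n⇒m<n∨m≡n lo≤i
  ...   | inj₁ lo<i = i , lo<i , <-≤-trans i< (+-monoʳ-≤ n (n≤1+n lo)) , eq
  -- Only the index `lo` leaves the window; it comes back as `n + lo`.
  ...   | inj₂ refl = n + lo , +-monoˡ-≤ lo (>-nonZero⁻¹ n) , +-monoʳ-< n ≤-refl
                    , trans eq (p-cong (sym ([n+m]%n≡m%n lo)))

  s∣suc[i%n]⇔ : ∀ i → (s ∣ suc (i % n) → s ∣ suc i) × (s ∣ suc i → s ∣ suc (i % n))
  s∣suc[i%n]⇔ i = (λ d → subst (s ∣_) (sym division) (∣m∣n⇒∣m+n d (∣n⇒∣m*n (i / n) s∣n)))
    , λ d → ∣m+n∣m⇒∣n (subst (s ∣_) (trans division (+-comm (suc (i % n)) (i / n * n))) d) (∣n⇒∣m*n (i / n) s∣n)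
    where
    division : suc i ≡ suc (i % n) + i / n * n
    division = cong suc (m≡m%n+[m/n]*n i n)

  suc[pred]%n : ∀ {b} → suc b ≡ n → suc b % n ≡ 0
  suc[pred]%n eq = trans (cong (_% n) eq) (n%n≡0 n)

  rim-edge : ∀ {a b} → a < n → GearEdge m r (suc a) (suc b) → a % n ≡ suc b % n ⊎ b % n ≡ suc a % n
  rim-edge _ (inj₁ ())
  rim-edge {a} {b} _ (inj₂ (inj₁ (_ , _ , eq))) = Sum.map (cong (_% n)) (cong (_% n)) (∣m-n∣≡1⇒ a b eq)
  rim-edge a<n (inj₂ (inj₂ (refl , eq))) = inj₁ (trans (m<n⇒m%n≡m a<n) (sym (suc[pred]%n eq)))

  rim-adj : ∀ {i j} → Adj (p i) (p j) → p i ≡ p (suc j) ⊎ p j ≡ p (suc i)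
  rim-adj {i} {j} (_ , e) = Sum.map from from (case e of λ
    { (inj₁ e) → rim-edge (m%n<n i n) (subst₂ (GearEdge m r) (toℕ-p i) (toℕ-p j) e)
    ; (inj₂ e) → Sum.swap (rim-edge (m%n<n j n) (subst₂ (GearEdge m r) (toℕ-p j) (toℕ-p i) e)) })
    where
    from : ∀ {i j} → i % n % n ≡ suc (j % n) % n → p i ≡ p (suc j)
    from {i} {j} eq = p-cong (trans (sym (m%n%n≡m%n i n)) (trans eq (suc[m%n]%n≡suc[m]%n j)))

  hub-spoke : ∀ {i} → Adj zero (p i) → s ∣ suc i
  hub-spoke {i} (_ , inj₁ (inj₁ (_ , d))) = proj₁ (s∣suc[i%n]⇔ i) (subst (s ∣_) (toℕ-p i) d)
  hub-spoke (_ , inj₁ (inj₂ (inj₁ (0≢0 , _)))) = contradiction refl 0≢0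
  hub-spoke (_ , inj₁ (inj₂ (inj₂ (() , _))))
  hub-spoke (_ , inj₂ (inj₁ (() , _)))
  hub-spoke (_ , inj₂ (inj₂ (inj₁ (_ , 0≢0 , _)))) = contradiction refl 0≢0
  hub-spoke (_ , inj₂ (inj₂ (inj₂ (_ , 0≡n)))) = contradiction 0≡n (≢-nonZero⁻¹ n ∘ sym)

  adj-hub : ∀ {i} → s ∣ suc i → Adj zero (p i)
  adj-hub {i} d = (λ ()) , inj₁ (inj₁ (refl , subst (s ∣_) (sym (toℕ-p i)) (proj₂ (s∣suc[i%n]⇔ i) d)))

  p-distinct : ∀ {i j} → i < j → j < n + i → p i ≢ p j
  p-distinct i<j j< eq = %-distinct i<j j< (p-injective eq)

  p-cancel-suc : ∀ {i j} → p (suc i) ≡ p (suc j) → p i ≡ p j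
  p-cancel-suc {i} {j} eq = p-cong (%-cancel-suc {i} {j} (p-injective eq))

  neighbour : ∀ i {w} → Adj (p (suc i)) w → w ≡ p i ⊎ w ≡ p (2 + i) ⊎ (w ≡ zero × s ∣ 2 + i)
  neighbour i {zero} uw = inj₂ (inj₂ (refl , hub-spoke (symm uw)))
  neighbour i {suc f} uw with rim-adj (subst (Adj (p (suc i))) (p-toℕ f) uw)
  ... | inj₁ eq = inj₁ (trans (p-toℕ f) (p-cancel-suc (sym eq)))
  ... | inj₂ eq = inj₂ (inj₁ (trans (p-toℕ f) eq))

  2≤n : 2 ≤ n
  2≤n = ≤-trans 2≤s (≤-trans (m≤n+m s (s + s)) 3s≤n)

  adj-suc : ∀ i → Adj (p i) (p (suc i))
  adj-suc i = p-distinct ≤-refl (+-monoˡ-≤ i 2≤n) , edge (m≤n⇒m<n∨m≡n (m%n<n i n))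
    where
    edge : suc (i % n) < n ⊎ suc (i % n) ≡ n →
           GearEdge m r (toℕ (p i)) (toℕ (p (suc i))) ⊎ GearEdge m r (toℕ (p (suc i))) (toℕ (p i))
    edge (inj₁ <n) = inj₁ (inj₂ (inj₁ ((λ ()) , (λ ()) , trans
      (cong₂ ∣_-_∣ (toℕ-p i) (trans (toℕ-p (suc i)) (cong suc (trans (sym (suc[m%n]%n≡suc[m]%n i)) (m<n⇒m%n≡m <n)))))
      (∣n-suc[n]∣≡1 (i % n)))))
    edge (inj₂ ≡n) = inj₂ (inj₂ (inj₂ (trans (toℕ-p (suc i)) (cong suc (trans (sym (suc[m%n]%n≡suc[m]%n i)) (suc[pred]%n ≡n)))
      , trans (toℕ-p i) ≡n)))

  hubbedCycle : HubbedCycle s (Gr m r)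
  hubbedCycle = record
    { 2≤s = 2≤s ; s∣n = s∣n ; 3s≤n = 3s≤n ; p = p ; p≢0 = λ ()
    ; p-shift = λ i → p-cong ([n+m]%n≡m%n i)
    ; p-distinct = p-distinct ; p-index = p-index
    ; p-cong-suc = λ {i} {j} eq → p-cong (%-cong-suc {i} {j} (p-injective eq))
    ; p-cancel-suc = p-cancel-suc
    ; adj-suc = adj-suc ; adj-hub = adj-hub ; hub-spoke = hub-spoke ; neighbour = neighbour }

-- Propagation times according to the parities of m and s

⌈n*2/2⌉≡n : ∀ n → ⌈ n * 2 /2⌉ ≡ n
⌈n*2/2⌉≡n zero    = refl
⌈n*2/2⌉≡n (suc n) = cong suc (⌈n*2/2⌉≡n n)

⌈1+n*2/2⌉≡1+n : ∀ n → ⌈ suc (n * 2) /2⌉ ≡ suc n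
⌈1+n*2/2⌉≡1+n zero    = refl
⌈1+n*2/2⌉≡1+n (suc n) = cong suc (⌈1+n*2/2⌉≡1+n n)

halves : ∀ n → ∃[ q ] (n ≡ q * 2 ⊎ n ≡ suc (q * 2))
halves n with n % 2 | m≡m%n+[m/n]*n n 2 | m%n<n n 2
... | 0           | eq | _ = n / 2 , inj₁ eq
... | 1           | eq | _ = n / 2 , inj₂ eq
... | suc (suc _) | _  | s≤s (s≤s ())

module PropagationTime {n s : ℕ} {G : Graph (suc n)} (H : HubbedCycle s G) where
  open HubbedCycle H
  open Rim H using (6≤n)
  open Starts H
  open UpperBound H

  fills⇒IsPropagationTime : ∀ {k} → FillsIn k → k ≡ ⌈ n /2⌉ ∸ 2 → IsPropagationTime G (⌈ n /2⌉ ∸ 2)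
  fills⇒IsPropagationTime (B , ∣B∣≤3 , B-full) refl = IsPropagationTime⁺ G ZeroForcing⇒3≤
    (λ B′ ∣B′∣≤3 j full → m≤n+o⇒m∸n≤o ⌈ n /2⌉ 2 (≤-trans (⌈n/2⌉-mono (blueAfter-bound ∣B′∣≤3 j full))
      (≤-reflexive (cong (2 +_) (⌈n*2/2⌉≡n j)))))
    ∣B∣≤3 B-full

  even-spokes : ∀ q → n ≡ q * 2 * s → IsPropagationTime G (⌈ n /2⌉ ∸ 2)
  even-spokes q n≡ with m≤n⇒∃[o]m+o≡n s+2≤ | m≤n⇒∃[o]m+o≡n (<⇒≤ 2≤s)
    where
    double : q * 2 * s ≡ q * s * 2
    double = trans (*-assoc q 2 s) (trans (cong (q *_) (*-comm 2 s)) (sym (*-assoc q s 2)))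
    2≤q : 2 ≤ q
    2≤q = ≰⇒> λ q≤1 → <⇒≱ (≤-trans (m<m+n (s + s) (<⇒≤ 2≤s)) 3s≤n) (begin
      n             ≡⟨ n≡ ⟩
      q * 2 * s     ≤⟨ *-monoˡ-≤ s (*-monoˡ-≤ 2 q≤1) ⟩
      2 * s         ≡⟨ cong (s +_) (+-identityʳ s) ⟩
      s + s         ∎)
      where open ≤-Reasoning
    s+2≤ : s + 2 ≤ q * s
    s+2≤ = ≤-trans (+-monoʳ-≤ s 2≤s) (≤-trans (≤-reflexive (cong (s +_) (sym (+-identityʳ s)))) (*-monoˡ-≤ s 2≤q))
  -- With `t` as `t₁ + s′`, the number `3 + t` is `q * s`, half the rim, so the vertex opposite to a
  -- spoke vertex is again one.
  ... | t₁ , h≡ | s′ , refl = fills⇒IsPropagationTime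
    (antipodal-start t₁ s′ (t₁ + s′) refl refl (divides q 3+t≡) n≡′)
    (trans (+-comm (t₁ + s′) 1) (cong (_∸ 2) (sym (trans (cong ⌈_/2⌉ n≡2h) (⌈n*2/2⌉≡n (3 + (t₁ + s′)))))))
    where
    3+t≡ : 3 + (t₁ + s′) ≡ q * suc s′
    3+t≡ = trans (rearrange t₁ s′) h≡
      where
      rearrange : ∀ t s → 3 + (t + s) ≡ suc s + 2 + t
      rearrange = solve-∀
    n≡2h : n ≡ (3 + (t₁ + s′)) * 2
    n≡2h = trans n≡ (trans (rearrange q (suc s′)) (cong (_* 2) (sym 3+t≡)))
      where
      rearrange : ∀ q s → q * 2 * s ≡ q * s * 2
      rearrange = solve-∀
    n≡′ : n ≡ (t₁ + s′) + (6 + (t₁ + s′))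
    n≡′ = trans n≡2h (rearrange (t₁ + s′))
      where
      rearrange : ∀ t → (3 + t) * 2 ≡ t + (6 + t)
      rearrange = solve-∀

  odd-rim : ∀ t → n ≡ t + (5 + t) → IsPropagationTime G (⌈ n /2⌉ ∸ 2)
  odd-rim t n≡ = fills⇒IsPropagationTime (centred-start t n≡)
    (trans (+-comm t 1) (cong (_∸ 2) (sym (trans (cong ⌈_/2⌉ (trans n≡ (rearrange t))) (⌈1+n*2/2⌉≡1+n (2 + t))))))
    where
    rearrange : ∀ t → t + (5 + t) ≡ suc ((2 + t) * 2)
    rearrange = solve-∀

  odd-spokes-even-spacing : ∀ q g → s ≡ suc (suc g) * 2 → n ≡ suc (suc q * 2) * s →
    IsPropagationTime G (⌈ n /2⌉ ∸ 2)
  odd-spokes-even-spacing q g s≡ n≡ with m≤n⇒∃[o]m+o≡n 4≤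
    where
    4≤s : 4 ≤ s
    4≤s = subst (4 ≤_) (sym s≡) (s≤s (s≤s (s≤s (s≤s z≤n))))
    4≤ : 4 ≤ suc q * s
    4≤ = ≤-trans 4≤s (m≤m+n s (q * s))
  -- The number `4 + t` is `suc q * s`, the distance from the spoke vertex at the start to the one
  -- that the hub forces.
  ... | t , 4+t≡ = fills⇒IsPropagationTime
    (offset-start t (suc g) (subst (4 ≤_) (sym s≡) (s≤s (s≤s (s≤s (s≤s z≤n))))) (trans s≡ (twice g))
      (divides (suc q) 4+t≡) n≡′)
    (trans (steps t g) (cong (_∸ 2) (sym (trans (cong ⌈_/2⌉ n≡2h) (⌈n*2/2⌉≡n (4 + t + suc (suc g)))))))
    where
    twice : ∀ g → suc (suc g) * 2 ≡ suc (suc g) + suc (suc g)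
    twice = solve-∀
    steps : ∀ t g → suc g + suc (t + 2) ≡ 2 + t + suc (suc g)
    steps = solve-∀
    n≡′ : n ≡ (4 + t) + (4 + t) + s
    n≡′ = trans n≡ (trans (rearrange (suc q) s) (cong (λ x → x + x + s) (sym 4+t≡)))
      where
      rearrange : ∀ q s → suc (q * 2) * s ≡ q * s + q * s + s
      rearrange = solve-∀
    n≡2h : n ≡ (4 + t + suc (suc g)) * 2
    n≡2h = trans n≡′ (trans (cong ((4 + t) + (4 + t) +_) s≡) (rearrange (4 + t) (suc (suc g))))
      where
      rearrange : ∀ t g → t + t + g * 2 ≡ (t + g) * 2
      rearrange = solve-∀

odd-spokes-spacing-2 : ∀ {n} {G : Graph (suc n)} (H : HubbedCycle 2 G) q → n ≡ suc (suc q * 2) * 2 →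
  IsPropagationTime G (suc q * 2)
odd-spokes-spacing-2 {n} {G} H q n≡ =
  let B , ∣B∣≤3 , B-full = UpperBound.hub-start H (suc q * 2) n≡′
  in IsPropagationTime⁺ G (Starts.ZeroForcing⇒3≤ H)
    -- As `n` is even, `n ≤ 3 + j * 2` already gives `n ≤ 2 + j * 2`.
    (λ B′ ∣B′∣≤3 j full → s≤s⁻¹ (s≤s⁻¹ (*-cancelʳ-< 2 (suc (suc q * 2)) (2 + j)
       (s≤s (subst (_≤ 3 + j * 2) n≡ (Alternating.alternating-bound H 4∤n ∣B′∣≤3 j full))))))
    ∣B∣≤3 B-full
  where
  n≡′ : n ≡ suc q * 2 + (2 + suc q * 2)
  n≡′ = trans n≡ (rearrange (suc q * 2))
    where
    rearrange : ∀ x → suc x * 2 ≡ x + (2 + x)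
    rearrange = solve-∀
  4∤n : ¬ 4 ∣ n
  4∤n d = >⇒∤ (s≤s (s≤s (s≤s z≤n))) (∣m+n∣m⇒∣n (subst (4 ∣_) (trans n≡ (rearrange q)) d) (n∣m*n (suc q)))
    where
    rearrange : ∀ q → suc (suc q * 2) * 2 ≡ suc q * 4 + 2
    rearrange = solve-∀

odd-spokes-otherwise : ∀ {n s} {G : Graph (suc n)} → HubbedCycle s G → ∀ q → n ≡ suc (suc q * 2) * s →
  s ≢ 2 → IsPropagationTime G (⌈ n /2⌉ ∸ 2)
odd-spokes-otherwise {n} {s} H q n≡ s≢2 with halves s
... | zero        , inj₁ refl = contradiction (HubbedCycle.2≤s H) λ ()
... | 1           , inj₁ refl = contradiction refl s≢2
... | suc (suc g) , inj₁ s≡   = PropagationTime.odd-spokes-even-spacing H q g s≡ n≡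
... | zero        , inj₂ refl = contradiction (HubbedCycle.2≤s H) λ { (s≤s ()) }
... | suc u       , inj₂ s≡   = PropagationTime.odd-rim H (q + u + suc q * suc u * 2)
  (trans n≡ (trans (cong (suc (suc q * 2) *_) s≡) (rearrange q u)))
  where
  rearrange : ∀ q u → suc (suc q * 2) * suc (suc u * 2) ≡
    q + u + suc q * suc u * 2 + (5 + (q + u + suc q * suc u * 2))
  rearrange = solve-∀

suc[q*2]%2≡1 : ∀ q → suc (q * 2) % 2 ≡ 1
suc[q*2]%2≡1 q = [m+kn]%n≡m%n 1 q 2

theorem2p4 : (m r : ℕ) → 3 ≤ m → 1 ≤ r →
    ((m % 2 ≡ 1 × r ≡ 1) → IsPropagationTime (Gr m r) (m ∸ 1))
    × (¬ (m % 2 ≡ 1 × r ≡ 1) → IsPropagationTime (Gr m r) (⌈ m * (r + 1) /2⌉ ∸ 2))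
theorem2p4 m r 3≤m 1≤r with Gear.hubbedCycle m r 3≤m 1≤r | halves m
... | H | q , inj₁ refl =
    (λ (odd , _) → case trans (sym (m*n%n≡0 q 2)) odd of λ ())
  , (λ _ → PropagationTime.even-spokes H q refl)
... | H | zero , inj₂ refl = contradiction 3≤m λ { (s≤s ()) }
... | H | suc q , inj₂ refl =
    (λ { (_ , refl) → odd-spokes-spacing-2 H q refl })
  , λ otherwise → odd-spokes-otherwise H q refl λ r+1≡2 →
      otherwise (suc[q*2]%2≡1 (suc q) , +-cancelʳ-≡ 1 r 1 r+1≡2)
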